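{- Let $q=2p$ be even with $p\ge2$, and let $\lambda=2\cos(\pi/q)$. For every $G_q$-irrational $x$ (in $[-\lambda/2,\lambda/2)$) there are infinitely many $n\in\mathbb{N}$ for which $$\Theta_n(x)\le\mathcal{H}_q=\frac12.$$ The constant $1/2$ is best possible, i.e. it cannot be replaced by any smaller constant in this statement.
   Context: Rosen continued fractions. For $x\in[-\lambda/2,\lambda/2)$, $x\neq 0$, let $\varepsilon(x)\in\{\pm1\}$ be the sign of $x$ and $r(x)=\left\lfloor \frac{1}{\lambda|x|}+\frac12\right\rfloor$. Define $f_q:[-\lambda/2,\lambda/2)\to[-\lambda/2,\lambda/2)$ by $f_q(x)=\frac{1}{|x|}-\lambda r(x)$ for $x\ne0$ and $f_q(0)=0$. Put $\varepsilon_n=\varepsilon(f_q^{n-1}(x))$ and $r_n=r(f_q^{n-1}(x))$ for $n\ge1$ as long as $f_q^{n-1}(x)\neq0$. This gives the Rosen expansion $$x=[\varepsilon_1:r_1,\varepsilon_2:r_2,\ldots]:=\cfrac{\varepsilon_1}{r_1\lambda+\cfrac{\varepsilon_2}{r_2\lambda+\cdots}}.$$ The number $x$ is $G_q$-rational if its Rosen expansion is finite (i.e. $f_q^m(x)=0$ for some $m\ge 0$), and $G_q$-irrational otherwise. Convergents: $R_n/S_n=[\varepsilon_1:r_1,\ldots,\varepsilon_n:r_n]$, with $R_{ -1}=1$, $R_0=0$, $S_{ -1}=0$, $S_0=1$, $R_n=r_n\lambda R_{n-1}+\varepsilon_nR_{n-2}$, $S_n=r_n\lambda S_{n-1}+\varepsilon_nS_{n-2}$.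 The approximation coefficients are $\Theta_n(x)=S_n^2\left|x-\frac{R_n}{S_n}\right|$, $n\ge0$. -}

module Defs where

open import Algebra.Bundles using (CommutativeRing)
open import Algebra.Structures using (IsCommutativeRing)
open import Data.Fin.Base using (toℕ)
open import Data.Nat.Base as ℕ using (ℕ; zero; suc)
open import Data.Nat.GeneralisedArithmetic using (fold)
open import Data.Product using (∃; _×_; _,_; proj₁; proj₂)
open import Data.Sum using (inj₁; inj₂)
open import Level using (0ℓ)
open import Relation.Binary.Definitions using (tri<; tri≈; tri>)
open import Relation.Binary.Structures using (IsStrictTotalOrder)
open import Relation.Nullary using (¬_; contradiction)
import Algebra.Properties.CommutativeMonoid.Sum as Sum
import Algebra.Properties.Semiring.Exp as Exp
import Algebra.Properties.Semiring.Mult as Mult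
import Relation.Binary.Construct.StrictToNonStrict as StrictToNonStrict
import Relation.Binary.Reasoning.Setoid as SetoidReasoning

-- The real numbers, axiomatised as a complete ordered field (unique up to
-- isomorphism).  Equality is a setoid equality, since Cauchy or Dedekind
-- reals cannot be quotiented here.  The reals are the classical ones: deciding
-- whether the supremum of { 0 } ∪ { 1 ∣ A } is positive decides A, so the
-- axioms entail excluded middle, and conversely excluded middle is what is
-- needed to construct a model.

record CompleteOrderedField : Set₁ where
  infix  4 _≈_ _<_
  infix  8 -_ _⁻¹
  infixl 7 _*_ _/_
  infixl 6 _+_
  field
    Carrier : Set
    _≈_ _<_ : Carrier → Carrier → Set
    _+_ _*_ : Carrier → Carrier → Carrier
    -_      : Carrier → Carrier
    0# 1#   : Carrier
    -- Total for convenience; the value 0# ⁻¹ is left unspecified.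
    _⁻¹     : Carrier → Carrier

    isCommutativeRing  : IsCommutativeRing _≈_ _+_ _*_ -_ 0# 1#
    isStrictTotalOrder : IsStrictTotalOrder _≈_ _<_
    ⁻¹-inverseʳ        : ∀ x → ¬ x ≈ 0# → x * x ⁻¹ ≈ 1#
    0<1                : 0# < 1#
    +-monoʳ-<          : ∀ z {x y} → x < y → z + x < z + y
    *-pos              : ∀ {x y} → 0# < x → 0# < y → 0# < x * y

  open StrictToNonStrict _≈_ _<_ public using (_≤_)

  field
    -- Least upper bounds; leastness is expressed by approximation from within.
    sup : (P : Carrier → Set) → ∃ P → (∃ λ b → ∀ x → P x → x ≤ b) →
          ∃ λ s → (∀ x → P x → x ≤ s) ×
                  (∀ y → y < s → ∃ λ x → P x × y < x)

  commutativeRing : CommutativeRing 0ℓ 0ℓ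
  commutativeRing = record { isCommutativeRing = isCommutativeRing }

  open CommutativeRing commutativeRing public
    hiding (Carrier; _≈_; _+_; _*_; -_; 0#; 1#; isCommutativeRing)
  open IsStrictTotalOrder isStrictTotalOrder public
    using (compare; _<?_; _≟_; <-resp-≈; <-respʳ-≈; <-respˡ-≈; asym; irrefl)
    renaming (trans to <-trans)

  _/_ : Carrier → Carrier → Carrier
  x / y = x * y ⁻¹

module Real (ℝ : CompleteOrderedField) where
  open CompleteOrderedField ℝ
  open Exp semiring using (_^_)
  open Mult semiring using () renaming (_×_ to _·_)
  open Sum +-commutativeMonoid using (sum-syntax)

  ι : ℕ → Carrier
  ι n = n · 1#

  2# ½ : Carrier
  2# = ι 2
  ½  = 1# / 2#

  ∣_∣ : Carrier → Carrier
  ∣ x ∣ with compare x 0#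
  ... | tri< _ _ _ = - x
  ... | tri≈ _ _ _ = x
  ... | tri> _ _ _ = x

  -- The supremum of { ι n ∣ ι n ≤ x } is approximated to within 1 by the
  -- integer part of x.
  floor-exists : ∀ x → 0# ≤ x → ∃ λ n → ι n ≤ x × x < ι (suc n)
  floor-exists x 0≤x = n , ιn≤x , x<ι[1+n]
    where
    P : Carrier → Set
    P y = ∃ λ n → y ≈ ι n × ι n ≤ x

    P-bounded : ∀ y → P y → y ≤ x
    P-bounded y (n , y≈ , inj₁ <x) = inj₁ (<-respˡ-≈ (sym y≈) <x)
    P-bounded y (n , y≈ , inj₂ ≈x) = inj₂ (trans y≈ ≈x)

    lub = sup P (0# , 0 , refl , 0≤x) (x , P-bounded)
    s   = proj₁ lub

    1+[s-1]≈s : 1# + (- 1# + s) ≈ s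
    1+[s-1]≈s = begin
      1# + (- 1# + s) ≈⟨ sym (+-assoc 1# (- 1#) s) ⟩
      (1# + - 1#) + s ≈⟨ +-congʳ (-‿inverseʳ 1#) ⟩
      0# + s          ≈⟨ +-identityˡ s ⟩
      s               ∎
      where open SetoidReasoning setoid

    s-1<s : - 1# + s < s
    s-1<s = <-respˡ-≈ (+-identityʳ _)
              (<-respʳ-≈ (trans (+-comm _ 1#) 1+[s-1]≈s)
                (+-monoʳ-< (- 1# + s) 0<1))

    near = proj₂ (proj₂ lub) (- 1# + s) s-1<s
    n    = proj₁ (proj₁ (proj₂ near))

    ιn≤x : ι n ≤ x
    ιn≤x = proj₂ (proj₂ (proj₁ (proj₂ near)))

    s<ι[1+n] : s < ι (suc n)
    s<ι[1+n] = <-respˡ-≈ 1+[s-1]≈s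
      (+-monoʳ-< 1# (<-respʳ-≈ (proj₁ (proj₂ (proj₁ (proj₂ near))))
                               (proj₂ (proj₂ near))))

    ι[1+n]≰x : ¬ ι (suc n) ≤ x
    ι[1+n]≰x ≤x with proj₁ (proj₂ lub) (ι (suc n)) (suc n , refl , ≤x)
    ... | inj₁ <s = asym <s s<ι[1+n]
    ... | inj₂ ≈s = irrefl (sym ≈s) s<ι[1+n]

    x<ι[1+n] : x < ι (suc n)
    x<ι[1+n] with compare x (ι (suc n))
    ... | tri< x< _ _ = x<
    ... | tri≈ _ x≈ _ = contradiction (inj₂ (sym x≈)) ι[1+n]≰x
    ... | tri> _ _ >x = contradiction (inj₁ >x) ι[1+n]≰x

  -- The floor of a nonnegative number (0 for negative arguments, which do
  -- not occur below).
  ⌊_⌋ : Carrier → ℕ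
  ⌊ x ⌋ with compare 0# x
  ... | tri< 0<x _ _ = proj₁ (floor-exists x (inj₁ 0<x))
  ... | tri≈ _ 0≈x _ = proj₁ (floor-exists x (inj₂ 0≈x))
  ... | tri> _ _ _   = 0

  _ConvergesTo_ : (ℕ → Carrier) → Carrier → Set
  u ConvergesTo a =
    ∀ ε → 0# < ε → ∃ λ N → ∀ n → N ℕ.≤ n → ∣ u n - a ∣ < ε

  cosTerm : Carrier → ℕ → Carrier
  cosTerm t k = ((- 1#) ^ k) * (t ^ (2 ℕ.* k)) / ι ((2 ℕ.* k) ℕ.!)

  IsCosine : (Carrier → Carrier) → Set
  IsCosine cos =
    ∀ t → (λ n → ∑[ k < n ] cosTerm t (toℕ k)) ConvergesTo cos t

  -- π is twice the least positive zero of the cosine.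
  IsPi : (Carrier → Carrier) → Carrier → Set
  IsPi cos π = 0# < π × cos (π / 2#) ≈ 0# ×
               (∀ t → 0# < t → t < π / 2# → ¬ cos t ≈ 0#)

module Rosen (ℝ : CompleteOrderedField) (lam : CompleteOrderedField.Carrier ℝ)
  where
  open CompleteOrderedField ℝ
  open Real ℝ

  InInterval : Carrier → Set
  InInterval x = - (lam / 2#) ≤ x × x < lam / 2#

  -- sgn and r are only meaningful for x ≉ 0#.
  sgn : Carrier → Carrier
  sgn x with compare x 0#
  ... | tri< _ _ _ = - 1#
  ... | tri≈ _ _ _ = 1#
  ... | tri> _ _ _ = 1#

  r : Carrier → ℕ
  r x = ⌊ 1# / (lam * ∣ x ∣) + ½ ⌋

  f : Carrier → Carrier
  f x with compare x 0#
  ... | tri< _ _ _ = 1# / ∣ x ∣ - lam * ι (r x)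
  ... | tri≈ _ _ _ = 0#
  ... | tri> _ _ _ = 1# / ∣ x ∣ - lam * ι (r x)

  f^ : ℕ → Carrier → Carrier
  f^ m x = fold x f m

  Rational : Carrier → Set
  Rational x = ∃ λ m → f^ m x ≈ 0#

  Irrational : Carrier → Set
  Irrational x = ¬ Rational x

  -- Digits are indexed from 0: digit n here is digit n + 1 of the expansion.
  εᵈ rᵈ : Carrier → ℕ → Carrier
  εᵈ x n = sgn (f^ n x)
  rᵈ x n = ι (r (f^ n x))

  -- Shifted by one, so as to start at index -1: R⁺ x k is R_{k-1}, and
  -- similarly for S⁺.
  R⁺ S⁺ : Carrier → ℕ → Carrier
  R⁺ x zero          = 1#
  R⁺ x (suc zero)    = 0#
  R⁺ x (suc (suc k)) = rᵈ x k * lam * R⁺ x (suc k) + εᵈ x k * R⁺ x k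
  S⁺ x zero          = 0#
  S⁺ x (suc zero)    = 1#
  S⁺ x (suc (suc k)) = rᵈ x k * lam * S⁺ x (suc k) + εᵈ x k * S⁺ x k

  R S Θ : Carrier → ℕ → Carrier
  R x n = R⁺ x (suc n)
  S x n = S⁺ x (suc n)
  Θ x n = S x n * S x n * ∣ x - R x n / S x n ∣

  -- Θ_n(x) ≤ C for infinitely many n, for every irrational x.
  IsApproximationConstant : Carrier → Set
  IsApproximationConstant C =
    ∀ x → InInterval x → Irrational x → ∀ N → ∃ λ n → N ℕ.≤ n × Θ x n ≤ C

-- Write t = f^n(x), a = S_{n-1}, b = S_n.  Then Θ_{n-1} > 1/2 says b + a t < 2 a.
-- If this holds for all large n, the AM-HM inequality makes every late t
-- negative.  With s = - t, the map is s ↦ k lam - 1 / s for both s and b / a,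
-- and b / a lies above a staircase (the boundary of the natural extension)
-- whose steps are ratios of D_j = C_j - C_{j+1}, where C_j = 2 cos (jπ/q).  The
-- only orbit that could stay bad is that of lam - 1, with period p - 1 and
-- values E_{j+1} / E_j, E_j = C_j + C_{j+1}; but badness puts s strictly above
-- that orbit, and the map is expanding there, so s would leave the interval.
-- Conversely, along the orbit of 1 - lam the quantity D_j b - D_{j+1} a stays
-- bounded while S_n tends to infinity, so liminf Θ_n ≥ 1/2 there.
--
-- About the cosine one needs only C_0 , … , C_{p-1} > 0 = C_p and the recurrence
-- C_{j+2} = lam C_{j+1} - C_j.  These follow from cos (s + t) + cos (s - t) =
-- 2 cos s cos t, obtained by multiplying the power series.

module Submission where

open import Defs
open import Data.Empty using (⊥)
open import Data.Fin.Base using (toℕ)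
open import Data.Integer.Base as ℤ using (ℤ; +_; -[1+_])
import Data.Integer.Properties as ℤ
open import Data.Maybe.Base using (Maybe; just; nothing)
open import Data.Nat.Base as ℕ using (ℕ; zero; suc)
import Data.Nat.Properties as ℕ
open import Data.Product using (∃; _×_; _,_; proj₁; proj₂)
open import Data.Sign.Base as Sign using (Sign)
open import Data.Sum using (_⊎_; inj₁; inj₂)
open import Function.Base using (_∘_)
open import Relation.Binary.Definitions using (Tri; tri<; tri≈; tri>)
open import Relation.Binary.PropositionalEquality.Core as ≡ using (_≡_)
open import Relation.Nullary using (¬_; Dec; yes; no; contradiction)
import Algebra.Properties.CommutativeMonoid.Sum as Sum
import Algebra.Properties.Ring as RingProperties
import Algebra.Properties.Semiring.Exp as Exp
import Algebra.Properties.Semiring.Mult as Mult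
import Algebra.Solver.Ring as RingSolver
import Algebra.Solver.Ring.AlmostCommutativeRing as ACR
import Relation.Binary.Construct.StrictToNonStrict as StrictToNonStrict
import Relation.Binary.Reasoning.Setoid as SetoidReasoning

-- With θ = π/q, D_j = 4 sin(θ/2) sin((j + ½)θ) and E_j = 4 cos(θ/2) cos((j + ½)θ) solve the same
-- recurrence u_{j+2} = lam u_{j+1} - u_j. Along the periodic digit word 1, ..., 1, 2 of length p -
-- 1 the ratios D_{j+1}/D_j form the attracting cycle of s ↦ k lam - 1/s and E_{j+1}/E_j the
-- repelling one. On the extremal orbit s equals E_{j+1}/E_j while S_n/S_{n-1} tends to D_{j+1}/D_j,
-- so at phase j the limit of Θ is D_j E_j / (D_{j+1} E_j - D_j E_{j+1}). The denominator is 2 D_0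
-- E_0 for every j, and D_j E_j is least at j = 0: this is where 1/2 comes from. The obstacle in the
-- upper bound is that a negative sign subtracts S_{n-1}, so that even S_n > 0 is not evident. The
-- staircase supplies it, as an invariant carried along each orbit; the natural extension itself is
-- never constructed.

module IntegerCoefficients (ℝ : CompleteOrderedField) where
  open CompleteOrderedField ℝ
  open Real ℝ using (ι)
  open Mult semiring using (×-homo-+; ×1-homo-*)
  open RingProperties ring
    using (-0#≈0#; -‿involutive; -‿+-comm; -‿distribˡ-*; -‿distribʳ-*)
  open SetoidReasoning setoid

  private
    φ : ℤ → Carrier
    φ (+ n)    = ι n
    φ -[1+ n ] = - ι (suc n)

    signed : Sign → Carrier → Carrier
    signed Sign.+ x = x
    signed Sign.- x = - x

    φ-⊖ : ∀ m n → φ (m ℤ.⊖ n) ≈ ι m + - ι n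
    φ-⊖ zero    zero    = sym (trans (+-identityˡ _) -0#≈0#)
    φ-⊖ zero    (suc n) = sym (+-identityˡ _)
    φ-⊖ (suc m) zero    = sym (trans (+-congˡ -0#≈0#) (+-identityʳ _))
    φ-⊖ (suc m) (suc n) = begin
      φ (suc m ℤ.⊖ suc n)             ≡⟨ ≡.cong φ (ℤ.[1+m]⊖[1+n]≡m⊖n m n) ⟩
      φ (m ℤ.⊖ n)                     ≈⟨ φ-⊖ m n ⟩
      ι m + - ι n                     ≈⟨ +-congˡ (sym (+-identityˡ _)) ⟩
      ι m + (0# + - ι n)              ≈⟨ +-congˡ (+-congʳ (sym (-‿inverseʳ 1#))) ⟩
      ι m + ((1# + - 1#) + - ι n)     ≈⟨ +-congˡ (+-assoc _ _ _) ⟩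
      ι m + (1# + (- 1# + - ι n))     ≈⟨ sym (+-assoc _ _ _) ⟩
      (ι m + 1#) + (- 1# + - ι n)     ≈⟨ +-cong (+-comm _ _) (-‿+-comm _ _) ⟩
      ι (suc m) + - ι (suc n)         ∎

    φ-+ : ∀ i j → φ (i ℤ.+ j) ≈ φ i + φ j
    φ-+ (+ m)    (+ n)    = ×-homo-+ 1# m n
    φ-+ (+ m)    -[1+ n ] = φ-⊖ m (suc n)
    φ-+ -[1+ m ] (+ n)    = trans (φ-⊖ n (suc m)) (+-comm _ _)
    φ-+ -[1+ m ] -[1+ n ] = begin
      - ι (suc (suc (m ℕ.+ n)))       ≡⟨ ≡.cong (λ k → - ι (suc k)) (≡.sym (ℕ.+-suc m n)) ⟩
      - ι (suc m ℕ.+ suc n)           ≈⟨ -‿cong (×-homo-+ 1# (suc m) (suc n)) ⟩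
      - (ι (suc m) + ι (suc n))       ≈⟨ sym (-‿+-comm _ _) ⟩
      - ι (suc m) + - ι (suc n)       ∎

    φ-◃ : ∀ s n → φ (s ℤ.◃ n) ≈ signed s (ι n)
    φ-◃ Sign.+ zero    = refl
    φ-◃ Sign.- zero    = sym -0#≈0#
    φ-◃ Sign.+ (suc n) = refl
    φ-◃ Sign.- (suc n) = refl

    φ-signed : ∀ i → φ i ≈ signed (ℤ.sign i) (ι ℤ.∣ i ∣)
    φ-signed (+ n)    = refl
    φ-signed -[1+ n ] = refl

    signed-cong : ∀ s {x y} → x ≈ y → signed s x ≈ signed s y
    signed-cong Sign.+ = λ x≈y → x≈y
    signed-cong Sign.- = -‿cong

    signed-* : ∀ s t x y → signed (s Sign.* t) (x * y) ≈ signed s x * signed t y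
    signed-* Sign.+ Sign.+ x y = refl
    signed-* Sign.+ Sign.- x y = -‿distribʳ-* x y
    signed-* Sign.- Sign.+ x y = -‿distribˡ-* x y
    signed-* Sign.- Sign.- x y = begin
      x * y           ≈⟨ sym (-‿involutive _) ⟩
      - (- (x * y))   ≈⟨ -‿cong (-‿distribʳ-* x y) ⟩
      - (x * - y)     ≈⟨ -‿distribˡ-* x (- y) ⟩
      - x * - y       ∎

    φ-* : ∀ i j → φ (i ℤ.* j) ≈ φ i * φ j
    φ-* i j = begin
      φ (i ℤ.* j)
        ≈⟨ φ-◃ s (ℤ.∣ i ∣ ℕ.* ℤ.∣ j ∣) ⟩
      signed s (ι (ℤ.∣ i ∣ ℕ.* ℤ.∣ j ∣))
        ≈⟨ signed-cong s (×1-homo-* ℤ.∣ i ∣ ℤ.∣ j ∣) ⟩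
      signed s (ι ℤ.∣ i ∣ * ι ℤ.∣ j ∣)
        ≈⟨ signed-* (ℤ.sign i) (ℤ.sign j) _ _ ⟩
      signed (ℤ.sign i) (ι ℤ.∣ i ∣) * signed (ℤ.sign j) (ι ℤ.∣ j ∣)
        ≈⟨ sym (*-cong (φ-signed i) (φ-signed j)) ⟩
      φ i * φ j ∎
      where s = ℤ.sign i Sign.* ℤ.sign j

    φ-neg : ∀ i → φ (ℤ.- i) ≈ - φ i
    φ-neg (+ zero)    = sym -0#≈0#
    φ-neg (+ (suc n)) = refl
    φ-neg -[1+ n ]    = sym (-‿involutive _)

  -- Only the clause for 1 deviates from ι: it makes `con 1` denote 1#
  -- definitionally, while `con 2` still denotes 2#.
  fromℤ : ℤ → Carrier
  fromℤ (+ 1) = 1#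
  fromℤ i     = φ i

  private
    fromℤ≈φ : ∀ i → fromℤ i ≈ φ i
    fromℤ≈φ (+ 0)             = refl
    fromℤ≈φ (+ 1)             = sym (+-identityʳ _)
    fromℤ≈φ (+ (suc (suc n))) = refl
    fromℤ≈φ -[1+ n ]          = refl

    almostCommutativeRing = ACR.fromCommutativeRing commutativeRing

    morphism : ℤ.+-*-rawRing ACR.-Raw-AlmostCommutative⟶ almostCommutativeRing
    morphism = record
      { ⟦_⟧    = fromℤ
      ; +-homo = λ i j → trans (fromℤ≈φ (i ℤ.+ j)) (trans (φ-+ i j)
                   (sym (+-cong (fromℤ≈φ i) (fromℤ≈φ j))))
      ; *-homo = λ i j → trans (fromℤ≈φ (i ℤ.* j)) (trans (φ-* i j)
                   (sym (*-cong (fromℤ≈φ i) (fromℤ≈φ j))))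
      ; -‿homo = λ i → trans (fromℤ≈φ (ℤ.- i)) (trans (φ-neg i)
                   (sym (-‿cong (fromℤ≈φ i))))
      ; 0-homo = refl
      ; 1-homo = refl
      }

    -- Comparison of integers computes, whereas the order of the field is abstract and would leave
    -- normal forms stuck.
    coefficient-≟ : ∀ i j → Maybe (fromℤ i ≈ fromℤ j)
    coefficient-≟ i j with i ℤ.≟ j
    ... | yes ≡.refl = just refl
    ... | no  _      = nothing

  open RingSolver ℤ.+-*-rawRing almostCommutativeRing morphism coefficient-≟ public
    using (solve; _:=_; _:+_; _:*_; _:-_; :-_; con; Polynomial)

  :0 :1 :2 : ∀ {n} → Polynomial n
  :0 = con (+ 0)
  :1 = con (+ 1)
  :2 = con (+ 2)

-- Ordered field arithmetic, absolute values, excluded middle.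

module OrderedField (ℝ : CompleteOrderedField) where
  open CompleteOrderedField ℝ
  open Real ℝ
  open IntegerCoefficients ℝ
  private module Order = StrictToNonStrict _≈_ _<_

  infixr 2 _⨾_
  _⨾_ = trans

  ≤-refl : ∀ {x} → x ≤ x
  ≤-refl = inj₂ refl

  ≤-trans : ∀ {x y z} → x ≤ y → y ≤ z → x ≤ z
  ≤-trans = Order.trans isEquivalence <-resp-≈ <-trans

  <-≤-trans : ∀ {x y z} → x < y → y ≤ z → x < z
  <-≤-trans = Order.<-≤-trans <-trans <-respʳ-≈

  ≤-<-trans : ∀ {x y z} → x ≤ y → y < z → x < z
  ≤-<-trans = Order.≤-<-trans sym <-trans <-respˡ-≈

  ≤-respʳ-≈ : ∀ {x y z} → y ≈ z → x ≤ y → x ≤ z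
  ≤-respʳ-≈ = Order.≤-respʳ-≈ trans <-respʳ-≈

  ≤-respˡ-≈ : ∀ {x y z} → y ≈ z → y ≤ x → z ≤ x
  ≤-respˡ-≈ = Order.≤-respˡ-≈ sym trans <-respˡ-≈

  <⇒≱ : ∀ {x y} → x < y → ¬ y ≤ x
  <⇒≱ x<y y≤x = irrefl refl (<-≤-trans x<y y≤x)

  ≤⊎> : ∀ x y → x ≤ y ⊎ y < x
  ≤⊎> x y with compare x y
  ... | tri< x<y _ _ = inj₁ (inj₁ x<y)
  ... | tri≈ _ x≈y _ = inj₁ (inj₂ x≈y)
  ... | tri> _ _ x>y = inj₂ x>y

  ≮⇒≥ : ∀ {x y} → ¬ x < y → y ≤ x
  ≮⇒≥ {x} {y} x≮y with ≤⊎> y x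
  ... | inj₁ y≤x = y≤x
  ... | inj₂ x<y = contradiction x<y x≮y

  ≰⇒> : ∀ {x y} → ¬ x ≤ y → y < x
  ≰⇒> {x} {y} x≰y with ≤⊎> x y
  ... | inj₁ x≤y = contradiction x≤y x≰y
  ... | inj₂ y<x = y<x

  x<y⇒0<y-x : ∀ {x y} → x < y → 0# < y + - x
  x<y⇒0<y-x {x} {y} x<y = <-respˡ-≈ (-‿inverseˡ x)
    (<-respʳ-≈ (+-comm (- x) y) (+-monoʳ-< (- x) x<y))

  x≤y⇒0≤y-x : ∀ {x y} → x ≤ y → 0# ≤ y + - x
  x≤y⇒0≤y-x (inj₁ x<y)         = inj₁ (x<y⇒0<y-x x<y)
  x≤y⇒0≤y-x {x} {y} (inj₂ x≈y) =
    inj₂ (sym (-‿inverseʳ x) ⨾ +-congʳ x≈y)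

  -- An inequality is certified by its positive difference, an equation that
  -- holds modulo hypotheses l ≈ r by its coefficient c at them.
  <-by : ∀ {x y e} → 0# < e → x + e ≈ y → x < y
  <-by {x} 0<e x+e≈y =
    <-respʳ-≈ x+e≈y (<-respˡ-≈ (+-identityʳ x) (+-monoʳ-< x 0<e))

  ≤-by : ∀ {x y e} → 0# ≤ e → x + e ≈ y → x ≤ y
  ≤-by     (inj₁ 0<e) x+e≈y = inj₁ (<-by 0<e x+e≈y)
  ≤-by {x} (inj₂ 0≈e) x+e≈y =
    inj₂ (sym (+-identityʳ x) ⨾ +-congˡ 0≈e ⨾ x+e≈y)

  modulo : ∀ {l r} → l ≈ r → ∀ c {x y} → x + c * r ≈ y + c * l → x ≈ y
  modulo {l} {r} l≈r c {x} {y} eq =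
    solve 2 (λ x k → x := (x :+ k) :- k) refl x (c * r)
    ⨾ +-congʳ (eq ⨾ +-congˡ (*-congˡ l≈r))
    ⨾ solve 2 (λ y k → (y :+ k) :- k := y) refl y (c * r)

  +-pos-nonneg : ∀ {x y} → 0# < x → 0# ≤ y → 0# < x + y
  +-pos-nonneg 0<x 0≤y = <-≤-trans 0<x (≤-by 0≤y refl)

  +-nonneg-pos : ∀ {x y} → 0# ≤ x → 0# < y → 0# < x + y
  +-nonneg-pos 0≤x 0<y = <-respʳ-≈ (+-comm _ _) (+-pos-nonneg 0<y 0≤x)

  +-pos : ∀ {x y} → 0# < x → 0# < y → 0# < x + y
  +-pos 0<x 0<y = +-pos-nonneg 0<x (inj₁ 0<y)

  +-nonneg : ∀ {x y} → 0# ≤ x → 0# ≤ y → 0# ≤ x + y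
  +-nonneg 0≤x 0≤y = ≤-trans 0≤x (≤-by 0≤y refl)

  *-nonneg : ∀ {x y} → 0# ≤ x → 0# ≤ y → 0# ≤ x * y
  *-nonneg (inj₁ 0<x) (inj₁ 0<y) = inj₁ (*-pos 0<x 0<y)
  *-nonneg (inj₁ _)   (inj₂ 0≈y) = inj₂ (sym (zeroʳ _) ⨾ *-congˡ 0≈y)
  *-nonneg (inj₂ 0≈x) _          = inj₂ (sym (zeroˡ _) ⨾ *-congʳ 0≈x)

  0<-x : ∀ {x} → x < 0# → 0# < - x
  0<-x x<0 = <-respʳ-≈ (+-identityˡ _) (x<y⇒0<y-x x<0)

  square-pos : ∀ {x} → ¬ x ≈ 0# → 0# < x * x
  square-pos {x} x≉0 with compare x 0#
  ... | tri< x<0 _ _ = <-respʳ-≈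
    (solve 1 (λ x → :- x :* :- x := x :* x) refl x) (*-pos (0<-x x<0) (0<-x x<0))
  ... | tri≈ _ x≈0 _ = contradiction x≈0 x≉0
  ... | tri> _ _ 0<x = *-pos 0<x 0<x

  square-nonneg : ∀ x → 0# ≤ x * x
  square-nonneg x with x ≟ 0#
  ... | yes x≈0 = inj₂ (sym (*-congˡ x≈0 ⨾ zeroʳ x))
  ... | no  x≉0 = inj₁ (square-pos x≉0)

  +-mono-≤ : ∀ {x y u v} → x ≤ y → u ≤ v → x + u ≤ y + v
  +-mono-≤ {x} {y} {u} {v} x≤y u≤v =
    ≤-by (+-nonneg (x≤y⇒0≤y-x x≤y) (x≤y⇒0≤y-x u≤v))
      (solve 4 (λ x y u v → x :+ u :+ (y :- x :+ (v :- u)) := y :+ v) refl x y u v)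

  *-monoˡ-≤ : ∀ {x y z} → 0# ≤ z → x ≤ y → z * x ≤ z * y
  *-monoˡ-≤ {x} {y} {z} 0≤z x≤y =
    ≤-by (*-nonneg 0≤z (x≤y⇒0≤y-x x≤y))
      (solve 3 (λ x y z → z :* x :+ z :* (y :- x) := z :* y) refl x y z)

  *-monoˡ-< : ∀ {x y z} → 0# < z → x < y → z * x < z * y
  *-monoˡ-< {x} {y} {z} 0<z x<y =
    <-by (*-pos 0<z (x<y⇒0<y-x x<y))
      (solve 3 (λ x y z → z :* x :+ z :* (y :- x) := z :* y) refl x y z)

  *-mono-≤ : ∀ {x y u v} → 0# ≤ x → 0# ≤ v → x ≤ y → u ≤ v → x * u ≤ y * v
  *-mono-≤ {x} {y} {u} {v} 0≤x 0≤v x≤y u≤v = ≤-trans (*-monoˡ-≤ 0≤x u≤v)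
    (≤-respˡ-≈ (*-comm v x) (≤-respʳ-≈ (*-comm v y) (*-monoˡ-≤ 0≤v x≤y)))

  *-cancelˡ-< : ∀ {z} x y → 0# ≤ z → z * x < z * y → x < y
  *-cancelˡ-< x y 0≤z zx<zy =
    ≰⇒> (λ y≤x → <⇒≱ zx<zy (*-monoˡ-≤ 0≤z y≤x))

  *-cancelˡ-≤ : ∀ {z} x y → 0# < z → z * x ≤ z * y → x ≤ y
  *-cancelˡ-≤ x y 0<z zx≤zy =
    ≮⇒≥ (λ y<x → <⇒≱ (*-monoˡ-< 0<z y<x) zx≤zy)

  *-cancelˡ-0< : ∀ {x y} → 0# ≤ x → 0# < x * y → 0# < y
  *-cancelˡ-0< {x} {y} 0≤x 0<xy =
    *-cancelˡ-< 0# y 0≤x (<-respˡ-≈ (sym (zeroʳ x)) 0<xy)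

  pos⇒≉0 : ∀ {x} → 0# < x → ¬ x ≈ 0#
  pos⇒≉0 0<x x≈0 = irrefl (sym x≈0) 0<x

  *-cancelˡ-≈ : ∀ {z} x y → 0# < z → z * x ≈ z * y → x ≈ y
  *-cancelˡ-≈ {z} x y 0<z zx≈zy =
    sym (unit x) ⨾ *-congˡ zx≈zy ⨾ unit y
    where
    unit : ∀ x → z ⁻¹ * (z * x) ≈ x
    unit x = modulo (⁻¹-inverseʳ z (pos⇒≉0 0<z)) x
      (solve 3 (λ x z w → w :* (z :* x) :+ x :* :1 := x :+ x :* (z :* w))
        refl x z (z ⁻¹))

  ⁻¹-pos : ∀ {x} → 0# < x → 0# < x ⁻¹
  ⁻¹-pos {x} 0<x = *-cancelˡ-0< (inj₁ 0<x)
    (<-respʳ-≈ (sym (⁻¹-inverseʳ x (pos⇒≉0 0<x))) 0<1)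

  *-/-cancel : ∀ {x} → 0# < x → ∀ y → x * (y / x) ≈ y
  *-/-cancel {x} 0<x y = modulo (⁻¹-inverseʳ x (pos⇒≉0 0<x)) y
    (solve 3 (λ x y z → x :* (y :* z) :+ y :* :1 := y :+ y :* (x :* z))
      refl x y (x ⁻¹))

  ι-nonneg : ∀ n → 0# ≤ ι n
  ι-nonneg zero    = ≤-refl
  ι-nonneg (suc n) = +-nonneg (inj₁ 0<1) (ι-nonneg n)

  ι-pos : ∀ n → 0# < ι (suc n)
  ι-pos n = +-pos-nonneg 0<1 (ι-nonneg n)

  ι-mono-≤ : ∀ {m n} → m ℕ.≤ n → ι m ≤ ι n
  ι-mono-≤ {n = n} ℕ.z≤n = ι-nonneg n
  ι-mono-≤ (ℕ.s≤s m≤n) = +-mono-≤ ≤-refl (ι-mono-≤ m≤n)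

  0<2 : 0# < 2#
  0<2 = ι-pos 1

  2*½≈1 : 2# * ½ ≈ 1#
  2*½≈1 = *-/-cancel 0<2 1#

  0<½ : 0# < ½
  0<½ = *-pos 0<1 (⁻¹-pos 0<2)

  archimedean : ∀ x → ∃ λ n → x < ι n
  archimedean x with ≤⊎> 0# x
  ... | inj₁ 0≤x =
    suc (proj₁ (floor-exists x 0≤x)) , proj₂ (proj₂ (floor-exists x 0≤x))
  ... | inj₂ x<0 = 0 , x<0

  -- `upper` needs this to obtain an index from the mere refutation that all late indices are bad.
  excluded-middle : (A : Set) → Dec A
  excluded-middle A = decide (compare 0# s)
    where
    P : Carrier → Set
    P x = x ≈ 0# ⊎ (x ≈ 1# × A)

    P-bounded : ∀ x → P x → x ≤ 1#
    P-bounded x (inj₁ x≈0)       = inj₁ (<-respˡ-≈ (sym x≈0) 0<1)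
    P-bounded x (inj₂ (x≈1 , _)) = inj₂ x≈1

    lub = sup P (0# , inj₁ refl) (1# , P-bounded)
    s   = proj₁ lub

    decide : _ → Dec A
    decide (tri< 0<s _ _) with proj₂ (proj₂ lub) 0# 0<s
    ... | x , inj₁ x≈0     , 0<x = contradiction x≈0 (pos⇒≉0 0<x)
    ... | x , inj₂ (_ , a) , _   = yes a
    decide (tri≈ _ 0≈s _) = no λ a →
      <⇒≱ 0<1 (≤-respʳ-≈ (sym 0≈s) (proj₁ (proj₂ lub) 1# (inj₂ (refl , a))))
    decide (tri> _ _ s<0) =
      contradiction (proj₁ (proj₂ lub) 0# (inj₁ refl)) (<⇒≱ s<0)

  ∣∣-nonpos : ∀ {x} → x ≤ 0# → ∣ x ∣ ≈ - x
  ∣∣-nonpos {x} x≤0 with compare x 0#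
  ... | tri< _ _ _   = refl
  ... | tri≈ _ x≈0 _ = modulo x≈0 2#
    (solve 1 (λ x → x :+ :2 :* :0 := :- x :+ :2 :* x) refl x)
  ... | tri> _ _ 0<x = contradiction x≤0 (<⇒≱ 0<x)

  ∣∣-nonneg : ∀ {x} → 0# ≤ x → ∣ x ∣ ≈ x
  ∣∣-nonneg {x} 0≤x with compare x 0#
  ... | tri< x<0 _ _ = contradiction 0≤x (<⇒≱ x<0)
  ... | tri≈ _ _ _   = refl
  ... | tri> _ _ _   = refl

  0≤∣x∣ : ∀ x → 0# ≤ ∣ x ∣
  0≤∣x∣ x with ≤⊎> 0# x
  ... | inj₁ 0≤x = ≤-respʳ-≈ (sym (∣∣-nonneg 0≤x)) 0≤x
  ... | inj₂ x<0 = ≤-respʳ-≈ (sym (∣∣-nonpos (inj₁ x<0))) (inj₁ (0<-x x<0))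

  ∣∣-pos : ∀ {x} → ¬ x ≈ 0# → 0# < ∣ x ∣
  ∣∣-pos {x} x≉0 with compare x 0#
  ... | tri< x<0 _ _ = 0<-x x<0
  ... | tri≈ _ x≈0 _ = contradiction x≈0 x≉0
  ... | tri> _ _ 0<x = 0<x

  x≤∣x∣ : ∀ x → x ≤ ∣ x ∣
  x≤∣x∣ x with ≤⊎> 0# x
  ... | inj₁ 0≤x = inj₂ (sym (∣∣-nonneg 0≤x))
  ... | inj₂ x<0 = ≤-trans (inj₁ x<0) (0≤∣x∣ x)

  -x≤∣x∣ : ∀ x → - x ≤ ∣ x ∣
  -x≤∣x∣ x with ≤⊎> x 0#
  ... | inj₁ x≤0 = inj₂ (sym (∣∣-nonpos x≤0))
  ... | inj₂ 0<x = ≤-trans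
    (≤-by (inj₁ 0<x) (-‿inverseˡ x)) (0≤∣x∣ x)

  ∣x∣≤y : ∀ {x y} → x ≤ y → - x ≤ y → ∣ x ∣ ≤ y
  ∣x∣≤y {x} x≤y -x≤y with ≤⊎> 0# x
  ... | inj₁ 0≤x = ≤-respˡ-≈ (sym (∣∣-nonneg 0≤x)) x≤y
  ... | inj₂ x<0 = ≤-respˡ-≈ (sym (∣∣-nonpos (inj₁ x<0))) -x≤y

  ∣∣-cong : ∀ {x y} → x ≈ y → ∣ x ∣ ≈ ∣ y ∣
  ∣∣-cong {x} {y} x≈y with ≤⊎> 0# x
  ... | inj₁ 0≤x = ∣∣-nonneg 0≤x ⨾ x≈y ⨾ sym (∣∣-nonneg (≤-respʳ-≈ x≈y 0≤x))
  ... | inj₂ x<0 = ∣∣-nonpos (inj₁ x<0) ⨾ -‿cong x≈y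
                   ⨾ sym (∣∣-nonpos (inj₁ (<-respˡ-≈ x≈y x<0)))

  ∣x+y∣≤∣x∣+∣y∣ : ∀ x y → ∣ x + y ∣ ≤ ∣ x ∣ + ∣ y ∣
  ∣x+y∣≤∣x∣+∣y∣ x y = ∣x∣≤y (+-mono-≤ (x≤∣x∣ x) (x≤∣x∣ y))
    (≤-respˡ-≈ (solve 2 (λ x y → :- x :+ :- y := :- (x :+ y)) refl x y)
      (+-mono-≤ (-x≤∣x∣ x) (-x≤∣x∣ y)))

  ∣-x∣≈∣x∣ : ∀ x → ∣ - x ∣ ≈ ∣ x ∣
  ∣-x∣≈∣x∣ x with ≤⊎> 0# x
  ... | inj₁ 0≤x = ∣∣-nonpos (≤-by 0≤x (-‿inverseˡ x))
                   ⨾ solve 1 (λ x → :- (:- x) := x) refl x ⨾ sym (∣∣-nonneg 0≤x)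
  ... | inj₂ x<0 = ∣∣-nonneg (inj₁ (0<-x x<0)) ⨾ sym (∣∣-nonpos (inj₁ x<0))

  ∣x*y∣≈x*∣y∣ : ∀ {x} → 0# ≤ x → ∀ y → ∣ x * y ∣ ≈ x * ∣ y ∣
  ∣x*y∣≈x*∣y∣ {x} 0≤x y with ≤⊎> 0# y
  ... | inj₁ 0≤y = ∣∣-nonneg (*-nonneg 0≤x 0≤y) ⨾ *-congˡ (sym (∣∣-nonneg 0≤y))
  ... | inj₂ y<0 =
    ∣∣-nonpos (≤-by (*-nonneg 0≤x (inj₁ (0<-x y<0)))
      (solve 2 (λ x y → x :* y :+ x :* :- y := :0) refl x y))
    ⨾ solve 2 (λ x y → :- (x :* y) := x :* :- y) refl x y
    ⨾ *-congˡ (sym (∣∣-nonpos (inj₁ y<0)))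

  ∣x*y∣≈∣x∣*∣y∣ : ∀ x y → ∣ x * y ∣ ≈ ∣ x ∣ * ∣ y ∣
  ∣x*y∣≈∣x∣*∣y∣ x y with ≤⊎> 0# x
  ... | inj₁ 0≤x = ∣x*y∣≈x*∣y∣ 0≤x y ⨾ *-congʳ (sym (∣∣-nonneg 0≤x))
  ... | inj₂ x<0 =
    sym (∣-x∣≈∣x∣ (x * y))
    ⨾ ∣∣-cong (solve 2 (λ x y → :- (x :* y) := :- x :* y) refl x y)
    ⨾ ∣x*y∣≈x*∣y∣ (inj₁ (0<-x x<0)) y
    ⨾ *-congʳ (sym (∣∣-nonpos (inj₁ x<0)))

-- Partial sums, Cauchy products and null sequences.

module Series (ℝ : CompleteOrderedField) where
  open CompleteOrderedField ℝ
  open Real ℝ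
  open IntegerCoefficients ℝ
  open OrderedField ℝ

  Seq : Set
  Seq = ℕ → Carrier

  sumTo : Seq → ℕ → Carrier
  sumTo u zero    = 0#
  sumTo u (suc n) = u 0 + sumTo (u ∘ suc) n

  sumTo-cong : ∀ {u v} → (∀ n → u n ≈ v n) → ∀ n → sumTo u n ≈ sumTo v n
  sumTo-cong u≈v zero    = refl
  sumTo-cong u≈v (suc n) = +-cong (u≈v 0) (sumTo-cong (u≈v ∘ suc) n)

  sumTo-last : ∀ u n → sumTo u (suc n) ≈ sumTo u n + u n
  sumTo-last u zero    = +-comm _ _
  sumTo-last u (suc n) = +-congˡ (sumTo-last (u ∘ suc) n) ⨾ sym (+-assoc _ _ _)

  sumTo-+ : ∀ u v n → sumTo (λ i → u i + v i) n ≈ sumTo u n + sumTo v n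
  sumTo-+ u v zero    = sym (+-identityˡ 0#)
  sumTo-+ u v (suc n) = +-congˡ (sumTo-+ (u ∘ suc) (v ∘ suc) n)
    ⨾ solve 4 (λ a b x y → a :+ b :+ (x :+ y) := a :+ x :+ (b :+ y)) refl
        (u 0) (v 0) (sumTo (u ∘ suc) n) (sumTo (v ∘ suc) n)

  sumTo-* : ∀ k u n → sumTo (λ i → k * u i) n ≈ k * sumTo u n
  sumTo-* k u zero    = sym (zeroʳ k)
  sumTo-* k u (suc n) = +-congˡ (sumTo-* k (u ∘ suc) n) ⨾ sym (distribˡ _ _ _)

  sumTo-nonneg : ∀ {u} → (∀ n → 0# ≤ u n) → ∀ n → 0# ≤ sumTo u n
  sumTo-nonneg 0≤u zero    = ≤-refl
  sumTo-nonneg 0≤u (suc n) = +-nonneg (0≤u 0) (sumTo-nonneg (0≤u ∘ suc) n)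

  sumTo-mono : ∀ {u} → (∀ n → 0# ≤ u n) → ∀ k n → sumTo u n ≤ sumTo u (k ℕ.+ n)
  sumTo-mono 0≤u zero    n = ≤-refl
  sumTo-mono {u} 0≤u (suc k) n = ≤-trans (sumTo-mono 0≤u k n)
    (≤-by (0≤u (k ℕ.+ n)) (sym (sumTo-last u (k ℕ.+ n))))

  tail-dominated : ∀ {u w} → (∀ n → ∣ u n ∣ ≤ w n) → ∀ k n →
    ∣ sumTo u (k ℕ.+ n) + - sumTo u n ∣ ≤ sumTo w (k ℕ.+ n) + - sumTo w n
  tail-dominated {u} {w} dom zero n = ≤-respˡ-≈
    (sym (∣∣-cong (-‿inverseʳ _) ⨾ ∣∣-nonneg ≤-refl)) (inj₂ (sym (-‿inverseʳ _)))
  tail-dominated {u} {w} dom (suc k) n =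
    ≤-trans (≤-respˡ-≈ (∣∣-cong (split u)) (∣x+y∣≤∣x∣+∣y∣ _ _))
      (≤-respʳ-≈ (split w) (+-mono-≤ (tail-dominated {u} {w} dom k n) (dom (k ℕ.+ n))))
    where
    split : ∀ v → sumTo v (k ℕ.+ n) + - sumTo v n + v (k ℕ.+ n)
                  ≈ sumTo v (suc k ℕ.+ n) + - sumTo v n
    split v = solve 3 (λ a b c → a :- b :+ c := a :+ c :- b) refl (sumTo v (k ℕ.+ n)) (sumTo v n) (v (k ℕ.+ n))
              ⨾ +-congʳ (sym (sumTo-last v (k ℕ.+ n)))

  conv : Seq → Seq → Seq
  conv a b zero    = a 0 * b 0
  conv a b (suc n) = a 0 * b (suc n) + conv (a ∘ suc) b n

  conv-congˡ : ∀ {a a′ b} → (∀ n → a n ≈ a′ n) → ∀ n → conv a b n ≈ conv a′ b n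
  conv-congˡ a≈a′ zero    = *-congʳ (a≈a′ 0)
  conv-congˡ a≈a′ (suc n) = +-cong (*-congʳ (a≈a′ 0)) (conv-congˡ (a≈a′ ∘ suc) n)

  conv-congʳ : ∀ {a b b′} → (∀ n → b n ≈ b′ n) → ∀ n → conv a b n ≈ conv a b′ n
  conv-congʳ b≈b′ zero    = *-congˡ (b≈b′ 0)
  conv-congʳ b≈b′ (suc n) = +-cong (*-congˡ (b≈b′ (suc n))) (conv-congʳ b≈b′ n)

  conv-+ˡ : ∀ a a′ b n → conv (λ i → a i + a′ i) b n ≈ conv a b n + conv a′ b n
  conv-+ˡ a a′ b zero    = distribʳ _ _ _
  conv-+ˡ a a′ b (suc n) = +-congˡ (conv-+ˡ (a ∘ suc) (a′ ∘ suc) b n)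
    ⨾ solve 5 (λ x y z u v → (x :+ y) :* z :+ (u :+ v) := x :* z :+ u :+ (y :* z :+ v)) refl
        (a 0) (a′ 0) (b (suc n)) (conv (a ∘ suc) b n) (conv (a′ ∘ suc) b n)

  conv-*ˡ : ∀ k a b n → conv (λ i → k * a i) b n ≈ k * conv a b n
  conv-*ˡ k a b zero    = *-assoc _ _ _
  conv-*ˡ k a b (suc n) = +-congˡ (conv-*ˡ k (a ∘ suc) b n)
    ⨾ solve 4 (λ k x y z → k :* x :* y :+ k :* z := k :* (x :* y :+ z)) refl
        k (a 0) (b (suc n)) (conv (a ∘ suc) b n)

  conv-shiftʳ : ∀ a {b b′} k → b′ 0 ≈ 0# → (∀ n → b′ (suc n) ≈ k * b n) →
                ∀ n → conv a b′ (suc n) ≈ k * conv a b n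
  conv-shiftʳ a {b} {b′} k b′0 b′s zero =
    +-cong (*-congˡ (b′s 0)) (*-congˡ b′0)
    ⨾ solve 4 (λ x y k z → x :* (k :* y) :+ z :* :0 := k :* (x :* y)) refl
        (a 0) (b 0) k (a 1)
  conv-shiftʳ a {b} {b′} k b′0 b′s (suc n) =
    +-cong (*-congˡ (b′s (suc n))) (conv-shiftʳ (a ∘ suc) k b′0 b′s n)
    ⨾ solve 4 (λ x y k z → x :* (k :* y) :+ k :* z := k :* (x :* y :+ z)) refl
        (a 0) (b (suc n)) k (conv (a ∘ suc) b n)

  weighted : Seq → Seq
  weighted a n = ι n * a n

  -- Multiplying the n-th coefficient by n is the operator x d/dx on generating functions, hence a
  -- derivation of the Cauchy product. It replaces binomial coefficients in `power-+`.
  conv-leibniz : ∀ a b n →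
    ι n * conv a b n ≈ conv (weighted a) b n + conv a (weighted b) n
  conv-leibniz a b zero =
    solve 2 (λ x y → :0 :* (x :* y) := :0 :* x :* y :+ x :* (:0 :* y)) refl (a 0) (b 0)
  conv-leibniz a b (suc n) =
    solve 4 (λ k x y c → (:1 :+ k) :* (x :* y :+ c) := x :* ((:1 :+ k) :* y) :+ (c :+ k :* c)) refl
      (ι n) (a 0) (b (suc n)) (conv a′ b n)
    ⨾ +-congˡ (+-congˡ (conv-leibniz a′ b n))
    ⨾ solve 6 (λ x y z c d e → z :+ (c :+ (d :+ e)) := :0 :* x :* y :+ (c :+ d) :+ (z :+ e)) refl
        (a 0) (b (suc n)) (a 0 * weighted b (suc n)) (conv a′ b n)
        (conv (weighted a′) b n) (conv a′ (weighted b) n)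
    ⨾ +-congʳ (+-congˡ (sym (conv-+ˡ a′ (weighted a′) b n)
        ⨾ conv-congˡ (λ i → solve 2 (λ k x → x :+ k :* x := (:1 :+ k) :* x) refl (ι i) (a′ i)) n))
    where a′ = a ∘ suc

  triangle-front : ∀ a b n →
    sumTo (conv a b) (suc n) ≈ a 0 * sumTo b (suc n) + sumTo (conv (a ∘ suc) b) n
  triangle-front a b n =
    +-congˡ (sumTo-+ (λ i → a 0 * b (suc i)) (conv (a ∘ suc) b) n ⨾ +-congʳ (sumTo-* (a 0) (b ∘ suc) n))
    ⨾ solve 4 (λ x y z w → x :* y :+ (x :* z :+ w) := x :* (y :+ z) :+ w) refl
        (a 0) (b 0) (sumTo (b ∘ suc) n) (sumTo (conv (a ∘ suc) b) n)

  excess : Seq → Seq → ℕ → ℕ → Carrier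
  excess a b m n = sumTo a m * sumTo b n + - sumTo (conv a b) m

  excess-front : ∀ a b m n →
    excess a b (suc m) n ≈ a 0 * (sumTo b n + - sumTo b (suc m)) + excess (a ∘ suc) b m n
  excess-front a b m n = +-congˡ (-‿cong (triangle-front a b m))
    ⨾ solve 5 (λ x s t u w → (x :+ s) :* t :- (x :* u :+ w) := x :* (t :- u) :+ (s :* t :- w)) refl
        (a 0) (sumTo (a ∘ suc) m) (sumTo b n) (sumTo b (suc m)) (sumTo (conv (a ∘ suc) b) m)

  -- The excess is a sum over pairs i < m, j < n with i + j ≥ m, so absolute
  -- values can be taken termwise.
  excess-dominated : ∀ {a b a⁺ b⁺} → (∀ n → ∣ a n ∣ ≤ a⁺ n) → (∀ n → ∣ b n ∣ ≤ b⁺ n) →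
    ∀ m k → ∣ excess a b m (k ℕ.+ m) ∣ ≤ excess a⁺ b⁺ m (k ℕ.+ m)
  excess-dominated {a} {b} {a⁺} {b⁺} a≤ b≤ zero k =
    inj₂ (∣∣-cong (vanish b) ⨾ ∣∣-nonneg ≤-refl ⨾ sym (vanish b⁺))
    where
    vanish : ∀ b → 0# * sumTo b (k ℕ.+ 0) + - 0# ≈ 0#
    vanish b = solve 1 (λ x → :0 :* x :- :0 := :0) refl (sumTo b (k ℕ.+ 0))
  excess-dominated {a} {b} {a⁺} {b⁺} a≤ b≤ (suc m) k =
    ≤-respˡ-≈ (∣∣-cong (sym (excess-front a b m n)))
      (≤-respʳ-≈ (sym (excess-front a⁺ b⁺ m n))
        (≤-trans (∣x+y∣≤∣x∣+∣y∣ _ _) (+-mono-≤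
          (≤-respˡ-≈ (sym (∣x*y∣≈∣x∣*∣y∣ _ _))
            (*-mono-≤ (0≤∣x∣ _) (≤-trans (0≤∣x∣ _) (tail-dominated b≤ k (suc m)))
              (a≤ 0) (tail-dominated b≤ k (suc m))))
          (≡.subst (λ n → ∣ excess (a ∘ suc) b m n ∣ ≤ excess (a⁺ ∘ suc) b⁺ m n)
            (≡.sym (ℕ.+-suc k m))
            (excess-dominated (a≤ ∘ suc) b≤ m (suc k))))))
    where n = k ℕ.+ suc m

  conv-nonneg : ∀ {a b} → (∀ n → 0# ≤ a n) → (∀ n → 0# ≤ b n) → ∀ n → 0# ≤ conv a b n
  conv-nonneg 0≤a 0≤b zero    = *-nonneg (0≤a 0) (0≤b 0)
  conv-nonneg 0≤a 0≤b (suc n) =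
    +-nonneg (*-nonneg (0≤a 0) (0≤b (suc n))) (conv-nonneg (0≤a ∘ suc) 0≤b n)

  -- The rectangle i < m, j < n lies inside the triangle i + j < m + n.
  square≤triangle : ∀ {a b} → (∀ n → 0# ≤ a n) → (∀ n → 0# ≤ b n) → ∀ m n →
    sumTo a m * sumTo b n ≤ sumTo (conv a b) (m ℕ.+ n)
  square≤triangle 0≤a 0≤b zero n =
    ≤-respˡ-≈ (sym (zeroˡ _)) (sumTo-nonneg (conv-nonneg 0≤a 0≤b) n)
  square≤triangle {a} {b} 0≤a 0≤b (suc m) n =
    ≤-respˡ-≈ (sym (distribʳ _ _ _)) (≤-respʳ-≈ (sym (triangle-front a b (m ℕ.+ n)))
      (+-mono-≤ (*-monoˡ-≤ (0≤a 0) (sumTo-mono 0≤b (suc m) n))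
                (square≤triangle (0≤a ∘ suc) 0≤b m n)))

  Null : Seq → Set
  Null u = ∀ ε → 0# < ε → ∃ λ N → ∀ n → N ℕ.≤ n → ∣ u n ∣ < ε

  null-dominated : ∀ {u w} → (∀ n → ∣ u n ∣ ≤ w n) → Null w → Null u
  null-dominated dom null ε 0<ε = let N , small = null ε 0<ε in
    N , λ n N≤n → ≤-<-trans (≤-trans (dom n) (x≤∣x∣ _)) (small n N≤n)

  null-+ : ∀ {u v} → Null u → Null v → Null (λ n → u n + v n)
  null-+ {u} {v} null-u null-v ε 0<ε =
    let M , small-u = null-u (½ * ε) (*-pos 0<½ 0<ε)
        N , small-v = null-v (½ * ε) (*-pos 0<½ 0<ε)
    in M ℕ.⊔ N , λ n ⊔≤n → ≤-<-trans (∣x+y∣≤∣x∣+∣y∣ _ _)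
      (<-by (+-pos (x<y⇒0<y-x (small-u n (ℕ.≤-trans (ℕ.m≤m⊔n M N) ⊔≤n)))
                   (x<y⇒0<y-x (small-v n (ℕ.≤-trans (ℕ.m≤n⊔m M N) ⊔≤n))))
        (modulo 2*½≈1 ε
          (solve 4 (λ x y h e →
             x :+ y :+ (h :* e :- x :+ (h :* e :- y)) :+ e :* :1 := e :+ e :* (:2 :* h)) refl
            (∣ u n ∣) (∣ v n ∣) ½ ε)))

  null-scale : ∀ k {u} → Null u → Null (λ n → k * u n)
  null-scale k {u} null ε 0<ε =
    let N , small = null (ε / K) (*-pos 0<ε (⁻¹-pos 0<K)) in
    N , λ n N≤n → <-respˡ-≈ (sym (∣x*y∣≈∣x∣*∣y∣ _ _)) (≤-<-trans
      (≤-by (0≤∣x∣ (u n)) (solve 2 (λ k u → k :* u :+ u := (k :+ :1) :* u) refl (∣ k ∣) (∣ u n ∣)))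
      (<-respʳ-≈ (*-/-cancel 0<K ε) (*-monoˡ-< 0<K (small n N≤n))))
    where
    K   = ∣ k ∣ + 1#
    0<K = +-nonneg-pos (0≤∣x∣ k) 0<1

  null-* : ∀ {u v} → Null u → Null v → Null (λ n → u n * v n)
  null-* {u} {v} null-u null-v ε 0<ε =
    let M , small-u = null-u 1# 0<1
        N , small-v = null-v ε 0<ε
    in M ℕ.⊔ N , λ n ⊔≤n → <-respˡ-≈ (sym (∣x*y∣≈∣x∣*∣y∣ _ _))
      (≤-<-trans
        (≤-by (*-nonneg (x≤y⇒0≤y-x (inj₁ (small-u n (ℕ.≤-trans (ℕ.m≤m⊔n M N) ⊔≤n)))) (0≤∣x∣ (v n)))
          (solve 2 (λ x y → x :* y :+ (:1 :- x) :* y := y) refl (∣ u n ∣) (∣ v n ∣)))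
        (small-v n (ℕ.≤-trans (ℕ.m≤n⊔m M N) ⊔≤n)))

  null-cong : ∀ {u v} → (∀ n → u n ≈ v n) → Null u → Null v
  null-cong u≈v null ε 0<ε = let N , small = null ε 0<ε in
    N , λ n N≤n → <-respˡ-≈ (∣∣-cong (u≈v n)) (small n N≤n)

  -- Identities between limits are proved through this: their constant difference is exhibited as a
  -- null sequence.
  null-constant : ∀ {x} → Null (λ _ → x) → x ≈ 0#
  null-constant {x} null with x ≟ 0#
  ... | yes x≈0 = x≈0
  ... | no  x≉0 = let N , small = null (∣ x ∣) (∣∣-pos x≉0) in
    contradiction (small N ℕ.≤-refl) (irrefl refl)

  null-bound : ∀ {u x y} → Null u → (∀ n → x ≤ y + u n) → x ≤ y
  null-bound {u} {x} {y} null x≤ = ≮⇒≥ λ y<x →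
    let N , small = null (x + - y) (x<y⇒0<y-x y<x) in
    irrefl refl (≤-<-trans (x≤ N)
      (<-by (x<y⇒0<y-x (≤-<-trans (x≤∣x∣ (u N)) (small N ℕ.≤-refl)))
        (solve 3 (λ x y u → y :+ u :+ (x :- y :- u) := x) refl x y (u N))))

-- The exponential and cosine series.

module PowerSeries (ℝ : CompleteOrderedField) where
  open CompleteOrderedField ℝ
  open Real ℝ
  open IntegerCoefficients ℝ
  open OrderedField ℝ
  open Series ℝ
  open Exp semiring using (_^_; ^-congˡ)
  open Mult semiring using (×1-homo-*)
  open Sum +-commutativeMonoid using (sum-syntax)

  !-pos : ∀ n → 0# < ι (n ℕ.!)
  !-pos zero    = ι-pos 0
  !-pos (suc n) = <-respʳ-≈ (sym (×1-homo-* (suc n) (n ℕ.!))) (*-pos (ι-pos n) (!-pos n))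

  power : Carrier → Seq
  power x n = x ^ n / ι (n ℕ.!)

  power-zero : ∀ x → power x 0 ≈ 1#
  power-zero x = *-cancelˡ-≈ _ _ (!-pos 0) (*-/-cancel (!-pos 0) 1#
    ⨾ solve 0 (:1 := (:1 :+ :0) :* :1) refl)

  power-step : ∀ x n → ι (suc n) * power x (suc n) ≈ x * power x n
  power-step x n = *-cancelˡ-≈ _ _ (!-pos n)
    (solve 3 (λ f k q → f :* (k :* q) := k :* f :* q) refl (ι (n ℕ.!)) (ι (suc n)) (power x (suc n))
     ⨾ *-congʳ (sym (×1-homo-* (suc n) (n ℕ.!)))
     ⨾ *-/-cancel (!-pos (suc n)) (x ^ suc n)
     ⨾ *-congˡ (sym (*-/-cancel (!-pos n) (x ^ n)))
     ⨾ solve 3 (λ f x q → x :* (f :* q) := f :* (x :* q)) refl (ι (n ℕ.!)) x (power x n))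

  power-cong : ∀ {x y} → x ≈ y → ∀ n → power x n ≈ power y n
  power-cong x≈y n = *-congʳ (^-congˡ n x≈y)

  power-nonneg : ∀ {x} → 0# ≤ x → ∀ n → 0# ≤ power x n
  power-nonneg {x} 0≤x n = *-nonneg (^-nonneg n) (inj₁ (⁻¹-pos (!-pos n)))
    where
    ^-nonneg : ∀ n → 0# ≤ x ^ n
    ^-nonneg zero    = inj₁ 0<1
    ^-nonneg (suc n) = *-nonneg 0≤x (^-nonneg n)

  ∣power∣ : ∀ x n → ∣ power x n ∣ ≈ power (∣ x ∣) n
  ∣power∣ x n = ∣x*y∣≈∣x∣*∣y∣ _ _
    ⨾ *-cong (∣^∣ n) (∣∣-nonneg (inj₁ (⁻¹-pos (!-pos n))))
    where
    ∣^∣ : ∀ n → ∣ x ^ n ∣ ≈ ∣ x ∣ ^ n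
    ∣^∣ zero    = ∣∣-nonneg (inj₁ 0<1)
    ∣^∣ (suc n) = ∣x*y∣≈∣x∣*∣y∣ _ _ ⨾ *-congˡ (∣^∣ n)

  -- By Leibniz both sides satisfy (n + 1) u_{n+1} = (x + y) u_n with u_0 = 1.
  power-+ : ∀ x y n → conv (power x) (power y) n ≈ power (x + y) n
  power-+ x y zero = *-cong (power-zero x) (power-zero y) ⨾ *-identityˡ 1# ⨾ sym (power-zero (x + y))
  power-+ x y (suc n) = *-cancelˡ-≈ _ _ (ι-pos n)
    (conv-leibniz (power x) (power y) (suc n)
     ⨾ +-cong
         (+-congʳ (solve 2 (λ u v → :0 :* u :* v := :0) refl (power x 0) (power y (suc n)))
          ⨾ +-identityˡ _
          ⨾ conv-congˡ (power-step x) n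
          ⨾ conv-*ˡ x (power x) (power y) n)
         (conv-shiftʳ (power x) y (zeroˡ _) (power-step y) n)
     ⨾ solve 3 (λ x y c → x :* c :+ y :* c := (x :+ y) :* c) refl x y (conv (power x) (power y) n)
     ⨾ *-congˡ (power-+ x y n)
     ⨾ sym (power-step (x + y) n))

  module Tail (z : Carrier) (0≤z : 0# ≤ z) (k : ℕ) (2z≤k : 2# * z ≤ ι k) where

    halving : ∀ n → k ℕ.≤ n → 2# * power z (suc n) ≤ power z n
    halving n k≤n = *-cancelˡ-≤ _ _ (ι-pos n)
      (≤-by (*-nonneg (x≤y⇒0≤y-x (≤-trans 2z≤k (ι-mono-≤ (ℕ.m≤n⇒m≤1+n k≤n)))) (power-nonneg 0≤z n))
        (modulo (power-step z n) 2#
          (solve 4 (λ z i u v → i :* (:2 :* v) :+ (i :- :2 :* z) :* u :+ :2 :* (z :* u)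
                                := i :* u :+ :2 :* (i :* v))
            refl z (ι (suc n)) (power z n) (power z (suc n)))))

    decreasing : ∀ i n → k ℕ.≤ n → power z (i ℕ.+ n) ≤ power z n
    decreasing zero    n k≤n = ≤-refl
    decreasing (suc i) n k≤n = ≤-trans
      (≤-by (power-nonneg 0≤z (suc i ℕ.+ n))
        (solve 1 (λ u → u :+ u := :2 :* u) refl (power z (suc i ℕ.+ n))))
      (≤-trans (halving (i ℕ.+ n) (ℕ.≤-trans k≤n (ℕ.m≤n+m n i))) (decreasing i n k≤n))

    -- The last summand on the left makes the induction close: passing from N to N + 1 adds u_N to
    -- the sum, and 2 u_N drops to 2 u_{N+1} ≤ u_N.
    tail-telescope : ∀ i n → k ℕ.≤ n →
      sumTo (power z) (i ℕ.+ n) + - sumTo (power z) n + 2# * power z (i ℕ.+ n) ≤ 2# * power z n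
    tail-telescope zero    n k≤n = inj₂
      (solve 2 (λ s u → s :- s :+ u := u) refl (sumTo (power z) n) (2# * power z n))
    tail-telescope (suc i) n k≤n = ≤-trans
      (≤-by (x≤y⇒0≤y-x (halving (i ℕ.+ n) (ℕ.≤-trans k≤n (ℕ.m≤n+m n i))))
        (+-congʳ (+-congʳ (+-congʳ (sumTo-last (power z) (i ℕ.+ n))))
         ⨾ solve 4 (λ s t u v → s :+ u :- t :+ :2 :* v :+ (u :- :2 :* v) := s :- t :+ :2 :* u) refl
             (sumTo (power z) (i ℕ.+ n)) (sumTo (power z) n)
             (power z (i ℕ.+ n)) (power z (suc i ℕ.+ n))))
      (tail-telescope i n k≤n)

    tail-bound : ∀ i n → k ℕ.≤ n →
      sumTo (power z) (i ℕ.+ n) + - sumTo (power z) n ≤ 2# * power z n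
    tail-bound i n k≤n = ≤-trans
      (≤-by (*-nonneg (inj₁ 0<2) (power-nonneg 0≤z (i ℕ.+ n))) refl) (tail-telescope i n k≤n)

    -- Decay like 1/n is enough here, since it makes the terms small by the Archimedean property
    -- alone.
    n*power-bound : ∀ n → k ℕ.≤ n → ι (suc n) * power z (suc n) ≤ z * power z k
    n*power-bound n k≤n = ≤-respˡ-≈ (sym (power-step z n)) (*-monoˡ-≤ 0≤z
      (≡.subst (λ n → power z n ≤ power z k) (ℕ.m∸n+n≡m k≤n) (decreasing (n ℕ.∸ k) k ℕ.≤-refl)))

    power-small : ∀ ε → 0# < ε → ∃ λ N → ∀ n → N ℕ.≤ n → k ℕ.≤ n × 2# * power z n < ε
    power-small ε 0<ε = suc (k ℕ.+ L) , small
      where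
      B = 2# * (z * power z k) / ε
      L = proj₁ (archimedean B)

      small : ∀ n → suc (k ℕ.+ L) ℕ.≤ n → k ℕ.≤ n × 2# * power z n < ε
      small (suc n) (ℕ.s≤s k+L≤n) = ℕ.m≤n⇒m≤1+n k≤n ,
        *-cancelˡ-< _ _ (inj₁ (ι-pos n))
          (≤-<-trans
            (≤-respˡ-≈ (solve 3 (λ c i u → c :* (i :* u) := i :* (c :* u)) refl
                         2# (ι (suc n)) (power z (suc n)))
              (*-monoˡ-≤ (inj₁ 0<2) (n*power-bound n k≤n)))
            (<-≤-trans (<-respˡ-≈ (*-/-cancel 0<ε _) (*-monoˡ-< 0<ε (proj₂ (archimedean B))))
              (≤-respʳ-≈ (*-comm _ _) (*-monoˡ-≤ (inj₁ 0<ε) (ι-mono-≤ (ℕ.m≤n⇒m≤1+n L≤n))))))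
        where
        k≤n = ℕ.≤-trans (ℕ.m≤m+n k L) k+L≤n
        L≤n = ℕ.≤-trans (ℕ.m≤n+m L k) k+L≤n

  tail-null : ∀ z → 0# ≤ z → (g : ℕ → ℕ) → (∀ n → n ℕ.≤ g n) →
    Null (λ n → sumTo (power z) (g n ℕ.+ g n) + - sumTo (power z) (g n))
  tail-null z 0≤z g n≤g ε 0<ε =
    let N , small = power-small ε 0<ε in
    N , λ n N≤n → let k≤ , 2p<ε = small (g n) (ℕ.≤-trans N≤n (n≤g n)) in
      <-respˡ-≈ (sym (∣∣-nonneg (x≤y⇒0≤y-x (sumTo-mono (power-nonneg 0≤z) (g n) (g n)))))
        (≤-<-trans (tail-bound (g n) (g n) k≤) 2p<ε)
    where
    open Tail z 0≤z (proj₁ (archimedean (2# * z))) (inj₁ (proj₂ (archimedean (2# * z))))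

  -- χ n = cos (nπ/2)
  χ sg : Seq
  χ 0             = 1#
  χ 1             = 0#
  χ (suc (suc n)) = - χ n
  sg zero    = 1#
  sg (suc n) = - sg n

  -- The product-to-sum formula at multiples of π/2, with cos((i - j)π/2) written as (-1)^j cos((i +
  -- j)π/2) to avoid subtracting indices.
  χ-product : ∀ i j → 2# * (χ i * χ j) ≈ χ (i ℕ.+ j) * (1# + sg j)
  χ-product i zero = solve 1 (λ x → :2 :* (x :* :1) := x :* (:1 :+ :1)) refl (χ i)
    ⨾ *-congʳ (reflexive (≡.cong χ (≡.sym (ℕ.+-identityʳ i))))
  χ-product i (suc zero) =
    solve 2 (λ x y → :2 :* (x :* :0) := y :* (:1 :+ :- :1)) refl (χ i) (χ (i ℕ.+ 1))
  χ-product i (suc (suc j)) =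
    solve 2 (λ x y → :2 :* (x :* :- y) := :- (:2 :* (x :* y))) refl (χ i) (χ j)
    ⨾ -‿cong (χ-product i j)
    ⨾ solve 2 (λ x s → :- (x :* (:1 :+ s)) := :- x :* (:1 :+ :- (:- s))) refl (χ (i ℕ.+ j)) (sg j)
    ⨾ *-congʳ (reflexive (≡.cong χ (≡.sym (≡.trans (ℕ.+-suc i (suc j)) (≡.cong suc (ℕ.+-suc i j))))))

  -- The offset k is there for the induction, because the tail of `conv` shifts its first argument.
  χ-conv : ∀ a b k n →
    2# * conv (λ i → χ (k ℕ.+ i) * a i) (λ j → χ j * b j) n
    ≈ χ (k ℕ.+ n) * (conv a b n + conv a (λ j → sg j * b j) n)
  χ-conv a b k zero =
    solve 3 (λ x u v → :2 :* (x :* u :* (:1 :* v)) := x :* (u :* v :+ u :* (:1 :* v))) refl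
        (χ (k ℕ.+ 0)) (a 0) (b 0)
  χ-conv a b k (suc n) =
    solve 5 (λ x y u v c →
        :2 :* (x :* u :* (y :* v) :+ c) := :2 :* (x :* y) :* (u :* v) :+ :2 :* c) refl
      (χ (k ℕ.+ 0)) (χ (suc n)) (a 0) (b (suc n))
      (conv (λ i → χ (k ℕ.+ suc i) * a (suc i)) (λ j → χ j * b j) n)
    ⨾ +-cong
        (*-congʳ (*-congˡ (*-congʳ (reflexive (≡.cong χ (ℕ.+-identityʳ k)))) ⨾ χ-product k (suc n)))
        (*-congˡ (conv-congˡ (λ i → *-congʳ (reflexive (≡.cong χ (ℕ.+-suc k i)))) n)
         ⨾ χ-conv (a ∘ suc) b (suc k) n
         ⨾ *-congʳ (reflexive (≡.cong χ (≡.sym (ℕ.+-suc k n)))))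
    ⨾ solve 6 (λ x s u v c d →
        x :* (:1 :+ s) :* (u :* v) :+ x :* (c :+ d) := x :* (u :* v :+ c :+ (u :* (s :* v) :+ d))) refl
        (χ (k ℕ.+ suc n)) (sg (suc n)) (a 0) (b (suc n))
        (conv (a ∘ suc) b n) (conv (a ∘ suc) (λ j → sg j * b j) n)

  power-neg : ∀ x n → sg n * power x n ≈ power (- x) n
  power-neg x n = sym (*-assoc _ _ _) ⨾ *-congʳ (^-neg n)
    where
    ^-neg : ∀ n → sg n * x ^ n ≈ (- x) ^ n
    ^-neg zero    = *-identityˡ 1#
    ^-neg (suc n) = solve 3 (λ s x y → :- s :* (x :* y) := :- x :* (s :* y)) refl (sg n) x (x ^ n)
      ⨾ *-congˡ (^-neg n)

  -- The vanishing odd terms are kept, so that the index is the exponent and Cauchy products apply.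
  cosSeq : Carrier → Seq
  cosSeq x n = χ n * power x n

  cosSeq-conv : ∀ s t n →
    2# * conv (cosSeq s) (cosSeq t) n ≈ cosSeq (s + t) n + cosSeq (s + - t) n
  cosSeq-conv s t n = χ-conv (power s) (power t) 0 n
    ⨾ *-congˡ (+-cong (power-+ s t n)
        (conv-congʳ {a = power s} (power-neg t) n ⨾ power-+ s (- t) n))
    ⨾ distribˡ _ _ _

  ∣χ∣≤1 : ∀ n → ∣ χ n ∣ ≤ 1#
  ∣χ∣≤1 0             = inj₂ (∣∣-nonneg (inj₁ 0<1))
  ∣χ∣≤1 1             = ≤-respˡ-≈ (sym (∣∣-nonneg ≤-refl)) (inj₁ 0<1)
  ∣χ∣≤1 (suc (suc n)) = ≤-respˡ-≈ (sym (∣-x∣≈∣x∣ (χ n))) (∣χ∣≤1 n)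

  cosSeq-dominated : ∀ x n → ∣ cosSeq x n ∣ ≤ power (∣ x ∣) n
  cosSeq-dominated x n = ≤-respˡ-≈ (sym (∣x*y∣≈∣x∣*∣y∣ _ _ ⨾ *-congˡ (∣power∣ x n)))
    (≤-by (*-nonneg (x≤y⇒0≤y-x (∣χ∣≤1 n)) (power-nonneg (0≤∣x∣ x) n))
      (solve 2 (λ c q → c :* q :+ (:1 :- c) :* q := q) refl (∣ χ n ∣) (power (∣ x ∣) n)))

  partialCos : Carrier → Seq
  partialCos x n = sumTo (cosSeq x) (2 ℕ.* n)

  χ-even : ∀ n → χ (2 ℕ.* n) ≈ (- 1#) ^ n × χ (suc (2 ℕ.* n)) ≈ 0#
  χ-even zero = refl , refl
  χ-even (suc n) = let even , odd = χ-even n in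
    (reflexive (≡.cong χ (ℕ.*-suc 2 n)) ⨾ -‿cong even
      ⨾ solve 1 (λ x → :- x := :- :1 :* x) refl ((- 1#) ^ n)) ,
    (reflexive (≡.cong (χ ∘ suc) (ℕ.*-suc 2 n)) ⨾ -‿cong odd
      ⨾ solve 0 (:- :0 := :0) refl)

  partialCos≈ : ∀ x n → ∑[ k < n ] cosTerm x (toℕ k) ≈ partialCos x n
  partialCos≈ x n = sum≈sumTo (cosTerm x) n ⨾ pairs n
    where
    sum≈sumTo : ∀ u n → ∑[ k < n ] u (toℕ k) ≈ sumTo u n
    sum≈sumTo u zero    = refl
    sum≈sumTo u (suc n) = +-congˡ (sum≈sumTo (u ∘ suc) n)

    pairs : ∀ n → sumTo (cosTerm x) n ≈ partialCos x n
    pairs zero    = refl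
    pairs (suc n) = sumTo-last (cosTerm x) n
      ⨾ +-cong (pairs n) (*-assoc _ _ _ ⨾ *-congʳ (sym (proj₁ (χ-even n))))
      ⨾ sym (+-identityʳ _)
      ⨾ +-cong (sym (sumTo-last (cosSeq x) (2 ℕ.* n))) (sym (*-congʳ (proj₂ (χ-even n)) ⨾ zeroˡ _))
      ⨾ sym (sumTo-last (cosSeq x) (suc (2 ℕ.* n)))
      ⨾ reflexive (≡.cong (sumTo (cosSeq x)) (≡.sym (ℕ.*-suc 2 n)))

-- Product formula, continuity and sign of the cosine.

module Cosine (ℝ : CompleteOrderedField)
  (cos : CompleteOrderedField.Carrier ℝ → CompleteOrderedField.Carrier ℝ)
  (isCosine : Real.IsCosine ℝ cos)
  where
  open CompleteOrderedField ℝ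
  open Real ℝ
  open IntegerCoefficients ℝ
  open OrderedField ℝ
  open Series ℝ
  open PowerSeries ℝ

  error : Carrier → Seq
  error t n = partialCos t n + - cos t

  error-null : ∀ t → Null (error t)
  error-null t ε 0<ε = let N , small = isCosine t ε 0<ε in
    N , λ n N≤n → <-respˡ-≈ (∣∣-cong (+-congʳ (partialCos≈ t n))) (small n N≤n)

  -- Compatibility with the setoid equality is not assumed of `cos`; it follows because both values
  -- are limits of equal partial sums.
  cos-cong : ∀ {s t} → s ≈ t → cos s ≈ cos t
  cos-cong {s} {t} s≈t = modulo (null-constant difference-null) 1#
    (solve 2 (λ a b → a :+ :1 :* :0 := b :+ :1 :* (a :- b)) refl (cos s) (cos t))
    where
    difference-null : Null (λ _ → cos s + - cos t)
    difference-null = null-cong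
      (λ n → modulo (sumTo-cong (λ i → *-congˡ (power-cong s≈t i)) (2 ℕ.* n)) (- 1#)
        (solve 4 (λ p q a b → q :- b :+ :- :1 :* (p :- a) :+ :- :1 :* q
                              := a :- b :+ :- :1 :* p) refl
          (partialCos s n) (partialCos t n) (cos s) (cos t)))
      (null-+ (error-null t) (null-scale (- 1#) (error-null s)))

  square-excess : Carrier → Carrier → Seq
  square-excess s t n = excess (cosSeq s) (cosSeq t) (2 ℕ.* n) (2 ℕ.* n)

  -- Domination replaces the cosine terms by exponential ones at ∣ s ∣ and ∣ t ∣. Their Cauchy
  -- product is the exponential series at ∣ s ∣ + ∣ t ∣, and their rectangle is at most its sum up
  -- to 4n, so the excess is at most the block from 2n to 4n.
  square-excess-null : ∀ s t → Null (square-excess s t)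
  square-excess-null s t = null-dominated
    (λ n → ≤-trans (excess-dominated (cosSeq-dominated s) (cosSeq-dominated t) (2 ℕ.* n) 0)
      (+-mono-≤
        (≤-respʳ-≈ (sumTo-cong (power-+ (∣ s ∣) (∣ t ∣)) (2 ℕ.* n ℕ.+ 2 ℕ.* n))
          (square≤triangle (power-nonneg (0≤∣x∣ s)) (power-nonneg (0≤∣x∣ t)) (2 ℕ.* n) (2 ℕ.* n)))
        (inj₂ (-‿cong (sumTo-cong (power-+ (∣ s ∣) (∣ t ∣)) (2 ℕ.* n))))))
    (tail-null (∣ s ∣ + ∣ t ∣) (+-nonneg (0≤∣x∣ s) (0≤∣x∣ t)) (2 ℕ.*_) (λ n → ℕ.m≤m+n n _))

  2*triangle≈ : ∀ s t n → 2# * sumTo (conv (cosSeq s) (cosSeq t)) (2 ℕ.* n)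
                          ≈ partialCos (s + t) n + partialCos (s + - t) n
  2*triangle≈ s t n = sym (sumTo-* 2# (conv (cosSeq s) (cosSeq t)) (2 ℕ.* n))
    ⨾ sumTo-cong (cosSeq-conv s t) (2 ℕ.* n)
    ⨾ sumTo-+ (cosSeq (s + t)) (cosSeq (s + - t)) (2 ℕ.* n)

  cos-product : ∀ s t → cos (s + t) + cos (s + - t) ≈ 2# * (cos s * cos t)
  cos-product s t = modulo (null-constant defect-null) (- 1#)
    (solve 2 (λ x y → x :+ :- :1 :* :0 := y :+ :- :1 :* (y :- x)) refl
      (cos (s + t) + cos (s + - t)) (2# * (cos s * cos t)))
    where
    A = cos s
    B = cos t

    -- With a, b, u, v partial sums and A, B, U, V their limits, the defect becomes a combination of
    -- the excess `a * b - T` and of errors, each of them null.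
    expand : ∀ a b A B u v U V T → 2# * T ≈ u + v →
      2# * (a * b + - T) + ((u + - U) + (v + - V))
      + (- 2# * B * (a + - A) + (- 2# * A * (b + - B) + - 2# * ((a + - A) * (b + - B))))
      ≈ 2# * (A * B) + - (U + V)
    expand a b A B u v U V T 2T≈ = modulo 2T≈ (- 1#)
      (solve 9 (λ a b A B u v U V T →
         :2 :* (a :* b :- T) :+ ((u :- U) :+ (v :- V))
         :+ (:- :2 :* B :* (a :- A) :+ (:- :2 :* A :* (b :- B) :+ :- :2 :* ((a :- A) :* (b :- B))))
         :+ :- :1 :* (u :+ v)
         := :2 :* (A :* B) :- (U :+ V) :+ :- :1 :* (:2 :* T))
        refl a b A B u v U V T)

    defect-null : Null (λ _ → 2# * (A * B) + - (cos (s + t) + cos (s + - t)))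
    defect-null = null-cong
      (λ n → expand (partialCos s n) (partialCos t n) A B _ _ _ _ _ (2*triangle≈ s t n))
      (null-+
        (null-+ (null-scale 2# (square-excess-null s t))
                (null-+ (error-null (s + t)) (error-null (s + - t))))
        (null-+ (null-scale (- 2# * B) (error-null s))
          (null-+ (null-scale (- 2# * A) (error-null t))
                  (null-scale (- 2#) (null-* (error-null s) (error-null t))))))

  -- From index 2 on the dominating terms at least halve, so what follows the leading 1 is at most
  -- twice h²/2.
  1-cos-bound : ∀ h → ∣ h ∣ ≤ 1# → ∣ cos h + - 1# ∣ ≤ ∣ h ∣ * ∣ h ∣
  1-cos-bound h ∣h∣≤1 = null-bound shifted-null bound
    where
    z = ∣ h ∣
    open Tail z (0≤∣x∣ h) 2
      (≤-by (*-nonneg (inj₁ 0<2) (x≤y⇒0≤y-x ∣h∣≤1))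
        (solve 1 (λ z → :2 :* z :+ :2 :* (:1 :- z) := :2) refl z))

    first-two : sumTo (cosSeq h) 2 ≈ 1#
    first-two = +-cong (*-congˡ (power-zero h)) refl
      ⨾ solve 1 (λ q → :1 :* :1 :+ (:0 :* q :+ :0) := :1) refl (power h 1)

    2*power-2 : 2# * power z 2 ≈ z * z
    2*power-2 = power-step z 1 ⨾ *-congˡ
      (solve 1 (λ q → q := (:1 :+ :0) :* q) refl (power z 1)
       ⨾ power-step z 0 ⨾ *-congˡ (power-zero z) ⨾ *-identityʳ z)

    partial-bound : ∀ n → ∣ partialCos h (suc n) + - 1# ∣ ≤ z * z
    partial-bound n = ≡.subst (λ k → ∣ sumTo (cosSeq h) k + - 1# ∣ ≤ z * z)
      (≡.trans (ℕ.+-comm (2 ℕ.* n) 2) (≡.sym (ℕ.*-suc 2 n)))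
      (≤-respˡ-≈ (∣∣-cong (+-congˡ (-‿cong first-two)))
        (≤-trans (tail-dominated (cosSeq-dominated h) (2 ℕ.* n) 2)
          (≤-respʳ-≈ 2*power-2 (tail-bound (2 ℕ.* n) 2 ℕ.≤-refl))))

    shifted-null : Null (λ n → ∣ error h (suc n) ∣)
    shifted-null ε 0<ε = let N , small = error-null h ε 0<ε in
      N , λ n N≤n → <-respˡ-≈ (sym (∣∣-nonneg (0≤∣x∣ _))) (small (suc n) (ℕ.m≤n⇒m≤1+n N≤n))

    bound : ∀ n → ∣ cos h + - 1# ∣ ≤ z * z + ∣ error h (suc n) ∣
    bound n = ≤-trans
      (≤-respˡ-≈ (∣∣-cong (solve 2 (λ q c → q :- :1 :+ :- (q :- c) := c :- :1) refl
                   (partialCos h (suc n)) (cos h)))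
        (∣x+y∣≤∣x∣+∣y∣ _ _))
      (+-mono-≤ (partial-bound n) (inj₂ (∣-x∣≈∣x∣ _)))

  cos-0 : cos 0# ≈ 1#
  cos-0 = modulo (null-constant (null-dominated {w = λ _ → 0#}
      (λ _ → ≤-respʳ-≈ (*-congʳ ∣0∣ ⨾ zeroˡ _)
        (1-cos-bound 0# (≤-respˡ-≈ (sym ∣0∣) (inj₁ 0<1))))
      λ ε 0<ε → 0 , λ _ _ → <-respˡ-≈ (sym ∣0∣) 0<ε)) 1#
    (solve 1 (λ c → c :+ :1 :* :0 := :1 :+ :1 :* (c :- :1)) refl (cos 0#))
    where
    ∣0∣ : ∣ 0# ∣ ≈ 0#
    ∣0∣ = ∣∣-nonneg ≤-refl

  2cos²≈ : ∀ s → 2# * (cos s * cos s) ≈ cos (s + s) + 1#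
  2cos²≈ s = sym (cos-product s s) ⨾ +-congˡ (cos-cong (-‿inverseʳ s) ⨾ cos-0)

  -- The square of cos(s + h) - cos s cos h = - sin s sin h, stated without a sine. It comes from
  -- the product formula at the pairs (s, h) and (s + h, s - h).
  cos-deviation : ∀ s h → let A = cos s ; B = cos h ; X = cos (s + h) in
    (X + - (A * B)) * (X + - (A * B)) ≈ (1# + - (A * A)) * (1# + - (B * B))
  cos-deviation s h = *-cancelˡ-≈ _ _ 0<2
    (algebra (cos s) (cos h) (cos (s + h)) (cos (s + - h)) _ _ (cos-product s h)
      (sym (cos-product (s + h) (s + - h))
       ⨾ +-cong
           (cos-cong (solve 2 (λ s h → s :+ h :+ (s :- h) := s :+ s) refl s h))
           (cos-cong (solve 2 (λ s h → s :+ h :- (s :- h) := h :+ h) refl s h)))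
      (2cos²≈ s) (2cos²≈ h))
    where
    algebra : ∀ A B X Y S H → X + Y ≈ 2# * (A * B) → 2# * (X * Y) ≈ S + H →
      2# * (A * A) ≈ S + 1# → 2# * (B * B) ≈ H + 1# →
      2# * ((X + - (A * B)) * (X + - (A * B))) ≈ 2# * ((1# + - (A * A)) * (1# + - (B * B)))
    algebra A B X Y S H sum prod A² B² =
      modulo sum (2# * X) (modulo prod (- 1#) (modulo A² 1# (modulo B² 1#
        (solve 6 (λ A B X Y S H →
           :2 :* ((X :- A :* B) :* (X :- A :* B)) :+ :2 :* X :* (:2 :* (A :* B))
           :+ :- :1 :* (S :+ H) :+ :1 :* (S :+ :1) :+ :1 :* (H :+ :1)
           := :2 :* ((:1 :- A :* A) :* (:1 :- B :* B)) :+ :2 :* X :* (X :+ Y)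
           :+ :- :1 :* (:2 :* (X :* Y)) :+ :1 :* (:2 :* (A :* A)) :+ :1 :* (:2 :* (B :* B)))
          refl A B X Y S H))))

  min-pos : ∀ {x y} → 0# < x → 0# < y → ∃ λ δ → 0# < δ × δ ≤ x × δ ≤ y
  min-pos {x} {y} 0<x 0<y with ≤⊎> x y
  ... | inj₁ x≤y = x , 0<x , ≤-refl , x≤y
  ... | inj₂ y<x = y , 0<y , inj₁ y<x , ≤-refl

  SameSign : Carrier → Carrier → Set
  SameSign s δ = ∀ h → ∣ h ∣ < δ → 0# < cos s * cos (s + h)

  -- By cos-deviation, cos (s + h) has the sign of cos s cos h as soon as
  -- cos² s + cos² h > 1.
  locally-same-sign : ∀ s → ¬ cos s ≈ 0# →
    ∃ λ δ → 0# < δ × SameSign s δ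
  locally-same-sign s A≉0 = δ , 0<δ , same-sign
    where
    A = cos s
    0<½A² = *-pos 0<½ (square-pos A≉0)
    -- For z = ∣ h ∣ < 1 one has cos h ≥ 1 - z² ≥ 1 - z, so cos² s + cos² h - 1 ≥ cos² s - 2z + z²,
    -- which is positive once z < ½ cos² s.
    min = min-pos 0<1 0<½A²
    δ = proj₁ min
    0<δ = proj₁ (proj₂ min)

    same-sign : ∀ h → ∣ h ∣ < δ → 0# < A * cos (s + h)
    same-sign h z<δ = *-cancelˡ-0< (inj₁ (*-pos 0<2 0<B))
      (<-respʳ-≈
        (modulo (cos-deviation s h) 1#
          (solve 3 (λ A B X →
             X :* X :+ (A :* A :+ B :* B :- :1) :+ :1 :* ((:1 :- A :* A) :* (:1 :- B :* B))
             := :2 :* B :* (A :* X) :+ :1 :* ((X :- A :* B) :* (X :- A :* B)))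
            refl A B X))
        (+-nonneg-pos (square-nonneg X) 1<A²+B²))
      where
      B = cos h
      X = cos (s + h)
      z = ∣ h ∣

      z<1 : z < 1#
      z<1 = <-≤-trans z<δ (proj₁ (proj₂ (proj₂ min)))

      0<1-z = x<y⇒0<y-x z<1

      1-z≤B : 0# ≤ B + - (1# + - z)
      1-z≤B = ≤-by
        (+-nonneg
          (x≤y⇒0≤y-x (≤-trans (-x≤∣x∣ (B + - 1#)) (1-cos-bound h (inj₁ z<1))))
          (*-nonneg (0≤∣x∣ h) (inj₁ 0<1-z)))
        (solve 2 (λ B z → :0 :+ (z :* z :- :- (B :- :1) :+ z :* (:1 :- z)) := B :- (:1 :- z)) refl B z)

      0<B : 0# < B
      0<B = <-by (+-nonneg-pos 1-z≤B 0<1-z)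
        (solve 2 (λ B w → :0 :+ (B :- w :+ w) := B) refl B (1# + - z))

      1<A²+B² : 0# < A * A + B * B + - 1#
      1<A²+B² = <-by
        (+-nonneg-pos
          (+-nonneg (*-nonneg 1-z≤B (inj₁ (+-pos 0<B 0<1-z))) (square-nonneg z))
          (*-pos 0<2 (x<y⇒0<y-x (<-≤-trans z<δ (proj₂ (proj₂ (proj₂ min)))))))
        (modulo 2*½≈1 (A * A)
          (solve 4 (λ A B z h →
             :0 :+ ((B :- (:1 :- z)) :* (B :+ (:1 :- z)) :+ z :* z :+ :2 :* (h :* (A :* A) :- z))
             :+ A :* A :* :1
             := A :* A :+ B :* B :- :1 :+ A :* A :* (:2 :* h))
            refl A B z ½))

  positive-to-the-right : ∀ {s t δ} → SameSign s δ → 0# < δ → s < t → 0# < cos s →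
                          ∃ λ u → s < u × u ≤ t × 0# < cos u
  positive-to-the-right {s} {t} {δ} same-sign 0<δ s<t 0<cos-s =
    let h , 0<h , h≤ , s+h≤t = min-pos (*-pos 0<½ 0<δ) (x<y⇒0<y-x s<t)
        ∣h∣<δ = <-respˡ-≈ (sym (∣∣-nonneg (inj₁ 0<h))) (≤-<-trans h≤ ½δ<δ)
    in s + h
     , <-by 0<h refl
     , ≤-by (x≤y⇒0≤y-x s+h≤t) (solve 3 (λ s h t → s :+ h :+ (t :- s :- h) := t) refl s h t)
     , *-cancelˡ-0< (inj₁ 0<cos-s) (same-sign h ∣h∣<δ)
    where
    ½δ<δ : ½ * δ < δ
    ½δ<δ = <-by (*-pos 0<½ 0<δ) (modulo 2*½≈1 δ
      (solve 2 (λ h d → h :* d :+ h :* d :+ d :* :1 := d :+ d :* (:2 :* h)) refl ½ δ))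

  nonpositive-to-the-left : ∀ {s u δ} → SameSign s δ → cos s < 0# → s + - δ < u → u ≤ s →
                            ¬ 0# < cos u
  nonpositive-to-the-left {s} {u} {δ} same-sign cos-s<0 s-δ<u u≤s 0<cos-u =
    <⇒≱ 0<product (≤-by (inj₁ (*-pos (0<-x cos-s<0) 0<cos-u))
      (solve 2 (λ a b → a :* b :+ :- a :* b := :0) refl (cos s) (cos u)))
    where
    ∣u-s∣<δ : ∣ u + - s ∣ < δ
    ∣u-s∣<δ = <-respˡ-≈
      (sym (∣∣-nonpos (≤-by (x≤y⇒0≤y-x u≤s)
        (solve 2 (λ s u → u :- s :+ (s :- u) := :0) refl s u))))
      (<-by (x<y⇒0<y-x s-δ<u)
        (solve 3 (λ s u d → :- (u :- s) :+ (u :- (s :- d)) := d) refl s u δ))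

    0<product : 0# < cos s * cos u
    0<product = <-respʳ-≈
      (*-congˡ (cos-cong (solve 2 (λ s u → s :+ (u :- s) := u) refl s u)))
      (same-sign (u + - s) ∣u-s∣<δ)

  module _ (b : Carrier) (cos≉0 : ∀ t → 0# < t → t < b → ¬ cos t ≈ 0#) where

    PositiveUpTo : Carrier → Carrier → Set
    PositiveUpTo t u = 0# ≤ u × u ≤ t × 0# < cos u

    zero-positive : ∀ {t} → 0# ≤ t → PositiveUpTo t 0#
    zero-positive 0≤t = ≤-refl , 0≤t , <-respʳ-≈ (sym cos-0) 0<1

    -- At the supremum the cosine is not zero: the hypothesis covers s > 0, and cos 0 = 1 covers s =
    -- 0. If it is positive, it stays positive a little to the right, still within t; if negative,
    -- no point with positive cosine lies close on the left.
    supremum-impossible : ∀ {t} s → 0# ≤ t → t < b → cos t ≤ 0# →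
      (∀ u → PositiveUpTo t u → u ≤ s) →
      ¬ (∀ y → y < s → ∃ λ u → PositiveUpTo t u × y < u)
    supremum-impossible {t} s 0≤t t<b cos-t≤0 upper approx =
      let δ , 0<δ , same-sign = locally-same-sign s cos-s≉0 in
      by-sign δ 0<δ same-sign (compare (cos s) 0#)
      where
      0≤s : 0# ≤ s
      0≤s = upper 0# (zero-positive 0≤t)

      s≤t : s ≤ t
      s≤t = ≮⇒≥ λ t<s → let _ , (_ , u≤t , _) , t<u = approx t t<s in <⇒≱ t<u u≤t

      nonzero : 0# ≤ s → ¬ cos s ≈ 0#
      nonzero (inj₁ 0<s) cos-s≈0 = cos≉0 s 0<s (≤-<-trans s≤t t<b) cos-s≈0
      nonzero (inj₂ 0≈s) cos-s≈0 = irrefl (sym cos-s≈0 ⨾ sym (cos-cong 0≈s) ⨾ cos-0) 0<1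

      cos-s≉0 : ¬ cos s ≈ 0#
      cos-s≉0 = nonzero 0≤s

      strict : 0# < cos s → s ≤ t → s < t
      strict _       (inj₁ s<t) = s<t
      strict 0<cos-s (inj₂ s≈t) =
        contradiction (≤-respˡ-≈ (sym (cos-cong s≈t)) cos-t≤0) (<⇒≱ 0<cos-s)

      by-sign : ∀ δ → 0# < δ → SameSign s δ → Tri (cos s < 0#) (cos s ≈ 0#) (0# < cos s) → ⊥
      by-sign δ 0<δ same-sign (tri≈ _ cos-s≈0 _) = cos-s≉0 cos-s≈0
      by-sign δ 0<δ same-sign (tri> _ _ 0<cos-s) =
        let u , s<u , u≤t , 0<cos-u = positive-to-the-right same-sign 0<δ (strict 0<cos-s s≤t) 0<cos-s
        in <⇒≱ s<u (upper u (≤-trans 0≤s (inj₁ s<u) , u≤t , 0<cos-u))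
      by-sign δ 0<δ same-sign (tri< cos-s<0 _ _) =
        let u , positive , s-δ<u = approx (s + - δ)
              (<-by 0<δ (solve 2 (λ s d → s :- d :+ d := s) refl s δ))
        in nonpositive-to-the-left same-sign cos-s<0 s-δ<u (upper u positive)
             (proj₂ (proj₂ positive))

    cos-positive : ∀ t → 0# < t → t < b → 0# < cos t
    cos-positive t 0<t t<b = ≰⇒> λ cos-t≤0 →
      let s , upper , approx = sup (PositiveUpTo t) (0# , zero-positive (inj₁ 0<t))
                                 (t , λ _ positive → proj₁ (proj₂ positive))
      in supremum-impossible s (inj₁ 0<t) t<b cos-t≤0 upper approx

-- The Chebyshev values, the staircase and the repelling orbit.

module Chebyshev (ℝ : CompleteOrderedField)
                 (lam : CompleteOrderedField.Carrier ℝ) where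
  open CompleteOrderedField ℝ
  open Real ℝ

  -- C n is 2 cos nθ for lam = 2 cos θ.
  C D E : ℕ → Carrier
  C zero          = 2#
  C (suc zero)    = lam
  C (suc (suc n)) = lam * C (suc n) + - C n
  D n = C n + - C (suc n)
  E n = C n + C (suc n)

-- q = 2 p with p = 2 + m.
module Hecke (ℝ : CompleteOrderedField) (lam : CompleteOrderedField.Carrier ℝ) (m : ℕ)
  (C-pos  : ∀ j → j ℕ.≤ suc m →
            CompleteOrderedField._<_ ℝ (CompleteOrderedField.0# ℝ) (Chebyshev.C ℝ lam j))
  (C-zero : CompleteOrderedField._≈_ ℝ (Chebyshev.C ℝ lam (suc (suc m)))
            (CompleteOrderedField.0# ℝ))
  where
  open CompleteOrderedField ℝ
  open Real ℝ
  open IntegerCoefficients ℝ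
  open OrderedField ℝ
  open Chebyshev ℝ lam

  C-nonneg : ∀ j → j ℕ.≤ suc (suc m) → 0# ≤ C j
  C-nonneg j j≤2+m with ℕ.m≤n⇒m<n∨m≡n j≤2+m
  ... | inj₁ (ℕ.s≤s j≤1+m) = inj₁ (C-pos j j≤1+m)
  ... | inj₂ ≡.refl        = inj₂ (sym C-zero)

  0<lam : 0# < lam
  0<lam = C-pos 1 (ℕ.s≤s ℕ.z≤n)

  -- For lam ≥ 2 the sequence C would be positive and nondecreasing, against C_p = 0. This bound is
  -- what makes the map expanding, as s ≤ lam / 2 < 1.
  lam<2 : lam < 2#
  lam<2 = ≰⇒> λ 2≤lam → irrefl (sym C-zero) (proj₁ (increasing 2≤lam (suc (suc m))))
    where
    increasing : 2# ≤ lam → ∀ n → 0# < C n × C n ≤ C (suc n)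
    increasing 2≤lam zero    = 0<2 , 2≤lam
    increasing 2≤lam (suc n) =
      let 0<C , C≤C′ = increasing 2≤lam n
          0<C′       = <-≤-trans 0<C C≤C′
      in 0<C′ ,
         ≤-by (+-nonneg (*-nonneg (x≤y⇒0≤y-x 2≤lam) (inj₁ 0<C′)) (x≤y⇒0≤y-x C≤C′))
           (solve 3 (λ l c c′ → c′ :+ ((l :- :2) :* c′ :+ (c′ :- c)) := l :* c′ :- c)
             refl lam (C n) (C (suc n)))

  2≤lam² : 2# ≤ lam * lam
  2≤lam² = ≤-by (C-nonneg 2 (ℕ.s≤s (ℕ.s≤s ℕ.z≤n)))
    (solve 1 (λ l → :2 :+ (l :* l :- :2) := l :* l) refl lam)

  1<lam : 1# < lam
  1<lam = ≰⇒> λ lam≤1 → <⇒≱ 0<1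
    (≤-by (+-nonneg (+-nonneg (x≤y⇒0≤y-x 2≤lam²) (x≤y⇒0≤y-x lam≤1))
                    (*-nonneg (inj₁ 0<lam) (x≤y⇒0≤y-x lam≤1)))
      (solve 1 (λ l → :1 :+ ((l :* l :- :2) :+ (:1 :- l) :+ l :* (:1 :- l)) := :0) refl lam))

  0≤lam-1 : 0# ≤ lam + - 1#
  0≤lam-1 = inj₁ (x<y⇒0<y-x 1<lam)

  0<2-lam : 0# < 2# + - lam
  0<2-lam = x<y⇒0<y-x lam<2

  D-step : ∀ j → j ℕ.≤ suc m → D j ≤ D (suc j)
  D-step j j≤1+m = ≤-by (*-nonneg (inj₁ 0<2-lam) (C-nonneg (suc j) (ℕ.s≤s j≤1+m)))
    (solve 3 (λ l c c′ → c :- c′ :+ (:2 :- l) :* c′ := c′ :- (l :* c′ :- c))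
      refl lam (C j) (C (suc j)))

  0<D₀ : 0# < D 0
  0<D₀ = 0<2-lam

  D₀≤D : ∀ j → j ℕ.≤ suc (suc m) → D 0 ≤ D j
  D₀≤D zero    _             = ≤-refl
  D₀≤D (suc j) (ℕ.s≤s j≤1+m) =
    ≤-trans (D₀≤D j (ℕ.m≤n⇒m≤1+n j≤1+m)) (D-step j j≤1+m)

  D-pos : ∀ j → j ℕ.≤ suc (suc m) → 0# < D j
  D-pos j j≤2+m = <-≤-trans 0<D₀ (D₀≤D j j≤2+m)

  D≤D-last : ∀ i j → i ℕ.+ j ≡ suc m → D j ≤ D (suc m)
  D≤D-last zero    j ≡.refl = ≤-refl
  D≤D-last (suc i) j i+j≡m  = ≤-trans
    (D-step j (ℕ.≤-trans (ℕ.m≤n+m j (suc i)) (ℕ.≤-reflexive i+j≡m)))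
    (D≤D-last i (suc j) (≡.trans (ℕ.+-suc i j) i+j≡m))

  E-pos : ∀ j → j ℕ.≤ suc m → 0# < E j
  E-pos j j≤1+m = +-pos-nonneg (C-pos j j≤1+m) (C-nonneg (suc j) (ℕ.s≤s j≤1+m))

  E-step : ∀ j → j ℕ.≤ suc m → E (suc j) < E j
  E-step j j≤1+m =
    <-by (+-pos (D-pos j (ℕ.m≤n⇒m≤1+n j≤1+m)) (D-pos (suc j) (ℕ.s≤s j≤1+m)))
      (solve 3 (λ l c c′ → c′ :+ (l :* c′ :- c) :+ ((c :- c′) :+ (c′ :- (l :* c′ :- c)))
                           := c :+ c′)
        refl lam (C j) (C (suc j)))

  E≤E₀ : ∀ j → j ℕ.≤ suc m → E j ≤ E 0
  E≤E₀ zero    _     = ≤-refl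
  E≤E₀ (suc j) j<1+m =
    ≤-trans (inj₁ (E-step j j≤1+m)) (E≤E₀ j j≤1+m)
    where j≤1+m = ℕ.<⇒≤ j<1+m

  D₁≈ : D 1 ≈ (lam + 1#) * D 0
  D₁≈ = solve 1 (λ l → l :- (l :* l :- :2) := (l :+ :1) :* (:2 :- l)) refl lam

  E₁≈ : E 1 ≈ (lam + - 1#) * E 0
  E₁≈ = solve 1 (λ l → l :+ (l :* l :- :2) := (l :- :1) :* (:2 :+ l)) refl lam

  Cₚ₋₁ : Carrier
  Cₚ₋₁ = C (suc m)

  0<Cₚ₋₁ : 0# < Cₚ₋₁
  0<Cₚ₋₁ = C-pos (suc m) ℕ.≤-refl

  C-last : C m ≈ lam * Cₚ₋₁
  C-last = modulo C-zero (- 1#)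
    (solve 3 (λ l c c′ → c :+ (:- :1) :* :0 := l :* c′ :+ (:- :1) :* (l :* c′ :- c))
      refl lam (C m) Cₚ₋₁)

  D-last : D (suc m) ≈ Cₚ₋₁
  D-last = modulo C-zero (- 1#)
    (solve 2 (λ c c′ → c :- c′ :+ :- :1 :* :0 := c :+ :- :1 :* c′)
      refl Cₚ₋₁ (C (suc (suc m))))

  E-last : E (suc m) ≈ Cₚ₋₁
  E-last = modulo C-zero 1#
    (solve 2 (λ c c′ → c :+ c′ :+ :1 :* :0 := c :+ :1 :* c′)
      refl Cₚ₋₁ (C (suc (suc m))))

  Dₘ≈ : D m ≈ (lam + - 1#) * Cₚ₋₁
  Dₘ≈ = modulo C-last 1#
    (solve 3 (λ l c c′ → c :- c′ :+ :1 :* (l :* c′) := (l :- :1) :* c′ :+ :1 :* c)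
      refl lam (C m) Cₚ₋₁)

  Eₘ≈ : E m ≈ (lam + 1#) * Cₚ₋₁
  Eₘ≈ = modulo C-last 1#
    (solve 3 (λ l c c′ → c :+ c′ :+ :1 :* (l :* c′) := (l :+ :1) :* c′ :+ :1 :* c)
      refl lam (C m) Cₚ₋₁)

  D-ratio-≤ : ∀ j → j ℕ.≤ suc m → D (suc (suc j)) ≤ lam * D (suc j)
  D-ratio-≤ j j≤1+m = ≤-by (inj₁ (D-pos j (ℕ.m≤n⇒m≤1+n j≤1+m)))
    (solve 3 (λ l c c′ → l :* c′ :- c :- (l :* (l :* c′ :- c) :- c′) :+ (c :- c′)
                         := l :* (c′ :- (l :* c′ :- c)))
      refl lam (C j) (C (suc j)))

  D-ratio-≤′ : ∀ j → j ℕ.≤ suc m → D (suc j) ≤ (lam + 1#) * D j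
  D-ratio-≤′ zero    _     = inj₂ D₁≈
  D-ratio-≤′ (suc j) j<1+m = ≤-trans (D-ratio-≤ j (ℕ.<⇒≤ j<1+m))
    (≤-by (inj₁ (D-pos (suc j) (ℕ.m≤n⇒m≤1+n j<1+m)))
      (solve 2 (λ l d → l :* d :+ d := (l :+ :1) :* d) refl lam (D (suc j))))

  Cₚ₋₁≤C : ∀ i j → i ℕ.+ j ≡ suc m → Cₚ₋₁ ≤ C j
  Cₚ₋₁≤C zero    j ≡.refl = ≤-refl
  Cₚ₋₁≤C (suc i) j i+j≡m  = ≤-trans (Cₚ₋₁≤C i (suc j) (≡.trans (ℕ.+-suc i j) i+j≡m))
    (≤-by (inj₁ (D-pos j j≤2+m))
      (solve 2 (λ c c′ → c′ :+ (c :- c′) := c) refl (C j) (C (suc j))))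
    where
    j≤2+m = ℕ.m≤n⇒m≤1+n (ℕ.≤-trans (ℕ.m≤n+m j (suc i)) (ℕ.≤-reflexive i+j≡m))

  -- D increases up to D_{p-1} = C_{p-1}, and C decreases down to C_{p-1}.
  D≤Cₛ : ∀ j → j ℕ.≤ m → D j ≤ C (suc j)
  D≤Cₛ j j≤m = ≤-trans
    (D≤D-last (suc m ℕ.∸ j) j (ℕ.m∸n+n≡m (ℕ.m≤n⇒m≤1+n j≤m)))
    (≤-respˡ-≈ (sym D-last) (Cₚ₋₁≤C (m ℕ.∸ j) (suc j)
      (≡.trans (ℕ.+-suc _ j) (≡.cong suc (ℕ.m∸n+n≡m j≤m)))))

  D₀≤Cₚ₋₁ : D 0 ≤ Cₚ₋₁
  D₀≤Cₚ₋₁ = ≤-respʳ-≈ D-last (D≤D-last (suc m) 0 (ℕ.+-identityʳ _))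

  2Cₛ≤lamC : ∀ j → j ℕ.≤ suc m → 2# * C (suc j) ≤ lam * C j
  2Cₛ≤lamC zero    _     = inj₂ (*-comm _ _)
  2Cₛ≤lamC (suc i) i<1+m =
    ≤-by (inj₁ (+-pos (D-pos i (ℕ.m≤n⇒m≤1+n (ℕ.<⇒≤ i<1+m)))
                      (D-pos (suc i) (ℕ.m≤n⇒m≤1+n i<1+m))))
      (solve 3 (λ l c c′ → let c″ = l :* c′ :- c in
         :2 :* c″ :+ (c :- c′ :+ (c′ :- c″)) := l :* c′)
        refl lam (C i) (C (suc i)))

  -- Keeps the extremal orbit inside the interval. For j ≥ 1 it follows from lam E_j = E_{j-1} +
  -- E_{j+1} with E decreasing; E_0 has no predecessor and is treated apart.
  2Eₛ≤lamE : ∀ j → j ℕ.≤ suc m → 2# * E (suc j) ≤ lam * E j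
  2Eₛ≤lamE zero    _     = ≤-by (*-nonneg (inj₁ 0<2-lam) (inj₁ (E-pos 0 ℕ.z≤n)))
    (solve 1 (λ l → :2 :* (l :+ (l :* l :- :2)) :+ (:2 :- l) :* (:2 :+ l) := l :* (:2 :+ l))
      refl lam)
  2Eₛ≤lamE (suc i) i<1+m =
    ≤-by (+-nonneg (x≤y⇒0≤y-x (inj₁ (E-step i (ℕ.<⇒≤ i<1+m))))
                   (x≤y⇒0≤y-x (inj₁ (E-step (suc i) i<1+m))))
      (solve 3 (λ l c c′ →
         let e = c :+ c′ ; c″ = l :* c′ :- c ; e′ = c′ :+ c″ ; e″ = c″ :+ (l :* c″ :- c′) in
         :2 :* e″ :+ ((e :- e′) :+ (e′ :- e″)) := l :* e′)
        refl lam (C i) (C (suc i)))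

  -- D and E solve the same recurrence, whose step has determinant 1, so the expression is constant
  -- in j. Divided by D_j E_j it is the gap between the attracting and the repelling ratio at phase
  -- j.
  wronskian : ∀ j → D (suc j) * E j + - (D j * E (suc j)) ≈ 2# * (D 0 * E 0)
  wronskian zero    =
    solve 1 (λ l → let d₁ = l :- (l :* l :- :2) ; e₁ = l :+ (l :* l :- :2) in
      d₁ :* (:2 :+ l) :- (:2 :- l) :* e₁ := :2 :* ((:2 :- l) :* (:2 :+ l))) refl lam
  wronskian (suc j) =
    solve 3 (λ l c c′ →
      let c″ = l :* c′ :- c ; c‴ = l :* c″ :- c′ in
      (c″ :- c‴) :* (c′ :+ c″) :- (c′ :- c″) :* (c″ :+ c‴)
      := (c′ :- c″) :* (c :+ c′) :- (c :- c′) :* (c′ :+ c″))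
      refl lam (C j) (C (suc j))
    ⨾ wronskian j

  -- Hence no phase of the extremal orbit has a limit of Θ below 1/2. In trigonometric form D_j E_j
  -- = 4 sin θ sin((2j + 1)θ).
  D₀E₀≤DE : ∀ j → j ℕ.≤ suc m → D 0 * E 0 ≤ D j * E j
  D₀E₀≤DE j j≤1+m = *-cancelˡ-≤ _ _ 0<2 (≤-by
    (*-nonneg (inj₁ 0<2) (*-nonneg (C-nonneg (suc j) (ℕ.s≤s j≤1+m)) (x≤y⇒0≤y-x (2Cₛ≤lamC j j≤1+m))))
    (modulo (wronskian j) (- 1#)
      (solve 4 (λ l c c′ w →
        let c″ = l :* c′ :- c in
        w :+ :2 :* (c′ :* (l :* c :- :2 :* c′)) :+ :- :1 :* w
        := :2 :* ((c :- c′) :* (c :+ c′)) :+ :- :1 :* ((c′ :- c″) :* (c :+ c′) :- (c :- c′) :* (c′ :+ c″)))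
        refl lam (C j) (C (suc j)) (2# * (D 0 * E 0)))))

  -- For (a , b) = (S_{n-1} , S_n) and s = - f^n(x): a / b lies under the
  -- staircase of height D_j / D_{j+1} over s > C_{j+2} / C_{j+1} that bounds the
  -- domain of the natural extension.
  Below : Carrier → Carrier → Carrier → Set
  Below a b s =
    ∀ j → j ℕ.≤ suc m → C (suc (suc j)) < s * C (suc j) → a * D (suc j) ≤ D j * b

  below-start : ∀ s → Below 0# 1# s
  below-start s j j≤1+m _ = ≤-by (inj₁ (D-pos j (ℕ.m≤n⇒m≤1+n j≤1+m)))
    (solve 2 (λ d d′ → :0 :* d′ :+ d := d :* :1) refl (D j) (D (suc j)))

  -- The step j = p - 2 of the staircase: its threshold is C_p / C_{p-1} = 0 and its height D_{p-2}
  -- / D_{p-1} = lam - 1.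
  below-negative : ∀ {a b s} → 0# < s → Below a b s → a ≤ (lam + - 1#) * b
  below-negative {a} {b} {s} 0<s below = *-cancelˡ-≤ _ _ 0<Cₚ₋₁
    (≤-respˡ-≈ (*-congˡ D-last ⨾ *-comm a Cₚ₋₁)
      (≤-respʳ-≈ (*-congʳ Dₘ≈ ⨾ solve 3 (λ l c b → (l :- :1) :* c :* b := c :* ((l :- :1) :* b))
                                 refl lam Cₚ₋₁ b)
        (below m (ℕ.n≤1+n m) (<-respˡ-≈ (sym C-zero) (*-pos 0<s 0<Cₚ₋₁)))))

  -- After a digit 1, s′ = lam - 1/s ≤ lam - 2/lam = C_2 / C_1, so the condition of the step j = 0
  -- is void.
  first-step : ∀ {s s′} → 0# < s → 2# * s ≤ lam → s * s′ ≈ lam * s + - 1# →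
    ¬ C 2 < s′ * C 1
  first-step {s} {s′} 0<s 2s≤lam ss′ C<s′C =
    <⇒≱ (<-by (*-pos 0<s (x<y⇒0<y-x C<s′C))
      (modulo ss′ lam
        (solve 3 (λ s s′ l → l :+ s :* (s′ :* l :- (l :* l :- :2)) :+ l :* (l :* s :- :1)
                             := :2 :* s :+ l :* (s :* s′))
          refl s s′ lam)))
      2s≤lam

  -- The recurrences of C and D carry the threshold and the height of step i to those of step i + 1;
  -- step 0 is void.
  below-negative-1 : ∀ {a b s s′} → 0# < s → 2# * s ≤ lam →
    s * s′ ≈ lam * s + - 1# → Below a b s → Below b (lam * b + - a) s′
  below-negative-1 0<s 2s≤lam ss′ _ zero _ C<s′C =
    contradiction C<s′C (first-step 0<s 2s≤lam ss′)
  below-negative-1 {a} {b} {s} {s′} 0<s 2s≤lam ss′ below (suc i) i<1+m C<s′C =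
    ≤-by (x≤y⇒0≤y-x (below i (ℕ.<⇒≤ i<1+m) C<sC))
      (solve 5 (λ a b l c c′ →
         let d = c :- c′ ; c″ = l :* c′ :- c ; d′ = c′ :- c″ ; d″ = c″ :- (l :* c″ :- c′) in
         b :* d″ :+ (d :* b :- a :* d′) := d′ :* (l :* b :- a))
        refl a b lam (C i) (C (suc i)))
    where
    C<sC : C (suc (suc i)) < s * C (suc i)
    C<sC = <-by (*-pos 0<s (x<y⇒0<y-x C<s′C))
      (modulo ss′ (C (suc (suc i)))
        (solve 5 (λ s s′ l c c′ →
           c′ :+ s :* (s′ :* c′ :- (l :* c′ :- c)) :+ c′ :* (l :* s :- :1)
           := s :* c :+ c′ :* (s :* s′))
          refl s s′ lam (C (suc i)) (C (suc (suc i)))))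

  -- lam + 1 = D_1 / D_0 bounds all the ratios D_{j+1} / D_j, so the position of s′ does not matter.
  -- This covers every digit ≥ 2.
  below-large : ∀ {b b′ s′} → 0# ≤ b → (lam + 1#) * b ≤ b′ → Below b b′ s′
  below-large {b} {b′} 0≤b large j j≤1+m _ = ≤-trans
    (*-monoˡ-≤ 0≤b (D-ratio-≤′ j j≤1+m))
    (≤-respˡ-≈ (solve 3 (λ l b d → d :* ((l :+ :1) :* b) := b :* ((l :+ :1) :* d))
                 refl lam b (D j))
      (*-monoˡ-≤ (inj₁ (D-pos j (ℕ.m≤n⇒m≤1+n j≤1+m))) large))

  below-positive-1 : ∀ {a b t s′} → 0# ≤ a → 0# ≤ b → 0# < t → 2# * t ≤ lam →
    t * s′ ≈ lam * t + - 1# → Below b (lam * b + a) s′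
  below-positive-1 _ _ 0<t 2t≤lam ts′ zero _ C<s′C =
    contradiction C<s′C (first-step 0<t 2t≤lam ts′)
  below-positive-1 {a} {b} 0≤a 0≤b _ _ _ (suc i) i<1+m _ =
    ≤-by (+-nonneg (*-nonneg 0≤b (x≤y⇒0≤y-x (D-ratio-≤ i (ℕ.<⇒≤ i<1+m))))
                   (*-nonneg 0≤a (inj₁ (D-pos (suc i) (ℕ.m≤n⇒m≤1+n i<1+m)))))
      (solve 5 (λ a b l d d′ → b :* d′ :+ (b :* (l :* d :- d′) :+ a :* d) := d :* (l :* b :+ a))
        refl a b lam (D (suc i)) (D (suc (suc i))))

  digit-nonzero : ∀ {s s′ k} → 0# < s → 0# < s′ → s * s′ ≈ ι k * lam * s + - 1# → ¬ k ≡ 0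
  digit-nonzero {s} {s′} 0<s 0<s′ ss′ ≡.refl = <⇒≱ 0<1
    (≤-by (inj₁ (*-pos 0<s 0<s′))
      (modulo ss′ 1#
        (solve 3 (λ s s′ l → :1 :+ s :* s′ :+ :1 :* (:0 :* l :* s :- :1)
                             := :0 :+ :1 :* (s :* s′))
          refl s s′ lam)))

  digit-1 : ∀ {s s′ k} → s * s′ ≈ ι k * lam * s + - 1# → k ≡ 1 →
    s * s′ ≈ lam * s + - 1#
  digit-1 {s} ss′ ≡.refl = ss′ ⨾
    solve 2 (λ l s → (:1 :+ :0) :* l :* s :- :1 := l :* s :- :1) refl lam s

  digit-2 : ∀ {s s′ k} → s * s′ ≈ ι k * lam * s + - 1# → k ≡ 2 →
    s * s′ ≈ 2# * lam * s + - 1#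
  digit-2 ss′ ≡.refl = ss′

  -- The increasing map s ↦ lam - 1/s sends C_{j+1} / C_j to C_{j+2} / C_{j+1}; these ratios are the
  -- orbit of the endpoint lam / 2 = C_1 / C_0.
  C-forward : ∀ {s s′} j → 0# < s → s * s′ ≈ lam * s + - 1# →
    s * C j ≤ C (suc j) → s′ * C (suc j) ≤ C (suc (suc j))
  C-forward {s} {s′} j 0<s ss′ sC≤C = *-cancelˡ-≤ _ _ 0<s (≤-by (x≤y⇒0≤y-x sC≤C)
    (modulo ss′ (C (suc j))
      (solve 5 (λ s s′ l c c′ →
         s :* (s′ :* c′) :+ (c′ :- s :* c) :+ c′ :* (l :* s :- :1)
         := s :* (l :* c′ :- c) :+ c′ :* (s :* s′))
        refl s s′ lam (C j) (C (suc j)))))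

  below-cong : ∀ {a b b′ s} → b ≈ b′ → Below a b s → Below a b′ s
  below-cong b≈b′ below j j≤1+m C<sC = ≤-respʳ-≈ (*-congˡ b≈b′) (below j j≤1+m C<sC)

  negative-step-pos : ∀ {a b s} k → ¬ k ≡ 0 → 0# < b → 0# < s → Below a b s →
    0# < ι k * lam * b + - a
  negative-step-pos zero k≢0 _ _ _ = contradiction ≡.refl k≢0
  negative-step-pos {a} {b} (suc k) _ 0<b 0<s below =
    <-respʳ-≈
      (solve 4 (λ l b a k → b :+ (((l :- :1) :* b :- a) :+ k :* (l :* b)) := (:1 :+ k) :* l :* b :- a)
        refl lam b a (ι k))
      (+-pos-nonneg 0<b (+-nonneg (x≤y⇒0≤y-x (below-negative 0<s below))
        (*-nonneg (ι-nonneg k) (*-nonneg (inj₁ 0<lam) (inj₁ 0<b)))))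

  negative-step : ∀ {a b s s′} k → ¬ k ≡ 0 → 0# < b → 0# < s → 2# * s ≤ lam →
    s * s′ ≈ ι k * lam * s + - 1# → Below a b s → Below b (ι k * lam * b + - a) s′
  negative-step zero k≢0 _ _ _ _ _ = contradiction ≡.refl k≢0
  negative-step {a} {b} 1 _ _ 0<s 2s≤lam ss′ below =
    below-cong (solve 3 (λ l b a → l :* b :- a := (:1 :+ :0) :* l :* b :- a) refl lam b a)
      (below-negative-1 0<s 2s≤lam (digit-1 ss′ ≡.refl) below)
  negative-step {a} {b} (suc (suc k)) _ 0<b 0<s _ _ below = below-large (inj₁ 0<b)
    (≤-by (+-nonneg (x≤y⇒0≤y-x (below-negative 0<s below))
                    (*-nonneg (ι-nonneg k) (*-nonneg (inj₁ 0<lam) (inj₁ 0<b))))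
      (solve 4 (λ l b a k →
         (l :+ :1) :* b :+ (((l :- :1) :* b :- a) :+ k :* (l :* b))
         := (:1 :+ (:1 :+ k)) :* l :* b :- a)
        refl lam b a (ι k)))

  positive-step-pos : ∀ {a b} k → ¬ k ≡ 0 → 0# ≤ a → 0# < b → 0# < ι k * lam * b + a
  positive-step-pos zero    k≢0 _   _   = contradiction ≡.refl k≢0
  positive-step-pos (suc k) _   0≤a 0<b =
    +-pos-nonneg (*-pos (*-pos (ι-pos k) 0<lam) 0<b) 0≤a

  positive-step : ∀ {a b t s′} k → ¬ k ≡ 0 → 0# ≤ a → 0# < b → 0# < t → 2# * t ≤ lam →
    t * s′ ≈ ι k * lam * t + - 1# → Below b (ι k * lam * b + a) s′
  positive-step zero k≢0 _ _ _ _ _ = contradiction ≡.refl k≢0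
  positive-step {a} {b} 1 _ 0≤a 0<b 0<t 2t≤lam ts′ =
    below-cong (solve 3 (λ l b a → l :* b :+ a := (:1 :+ :0) :* l :* b :+ a) refl lam b a)
      (below-positive-1 0≤a (inj₁ 0<b) 0<t 2t≤lam (digit-1 ts′ ≡.refl))
  positive-step {a} {b} (suc (suc k)) _ 0≤a 0<b _ _ _ = below-large (inj₁ 0<b)
    (≤-by (+-nonneg (+-nonneg 0≤a (*-nonneg 0≤lam-1 (inj₁ 0<b)))
                    (*-nonneg (ι-nonneg k) (*-nonneg (inj₁ 0<lam) (inj₁ 0<b))))
      (solve 4 (λ l b a k →
         (l :+ :1) :* b :+ ((a :+ (l :- :1) :* b) :+ k :* (l :* b))
         := (:1 :+ (:1 :+ k)) :* l :* b :+ a)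
        refl lam b a (ι k)))

  -- With s n = - f^n(x) and (a n , b n) = (S_{n-1} , S_n), the hypothesis bad says
  -- that Θ_{n-1}(x) = a / (b - a s) exceeds 1/2.
  module NoBadOrbit
    (s a b : ℕ → Carrier) (κ : ℕ → ℕ)
    (0<s    : ∀ n → 0# < s n)
    (2s≤lam : ∀ n → 2# * s n ≤ lam)
    (ss′    : ∀ n → s n * s (suc n) ≈ ι (κ n) * lam * s n + - 1#)
    (a′     : ∀ n → a (suc n) ≈ b n)
    (b′     : ∀ n → b (suc n) ≈ ι (κ n) * lam * b n + - a n)
    (0<b    : ∀ n → 0# < b n)
    (below  : ∀ n → Below (a n) (b n) (s n))
    (bad    : ∀ n → b n < a n * (2# + s n))
    where

    s<1 : ∀ n → s n < 1#
    s<1 n = *-cancelˡ-< (s n) 1# (inj₁ 0<2) (≤-<-trans (2s≤lam n)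
      (<-respʳ-≈ (sym (*-identityʳ 2#)) lam<2))

    -- While the digits are 1, s stays under the orbit of lam / 2, which reaches C_p / C_{p-1} = 0
    -- at j = p - 1; but s is positive. Here i counts the steps left.
    some-large-digit : ∀ i j → i ℕ.+ j ≡ suc m → ∀ n → s n * C j ≤ C (suc j) →
                       ∃ λ n′ → 2 ℕ.≤ κ n′
    some-large-digit zero j ≡.refl n sC≤C =
      contradiction (≤-respʳ-≈ C-zero sC≤C) (<⇒≱ (*-pos (0<s n) 0<Cₚ₋₁))
    some-large-digit (suc i) j i+j≡m n sC≤C with κ n in eq
    ... | zero        = contradiction eq (digit-nonzero (0<s n) (0<s (suc n)) (ss′ n))
    ... | suc (suc k) = n , ≡.subst (2 ℕ.≤_) (≡.sym eq) (ℕ.s≤s (ℕ.s≤s ℕ.z≤n))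
    ... | suc zero    =
      some-large-digit i (suc j) (≡.trans (ℕ.+-suc i j) i+j≡m) (suc n)
        (C-forward j (0<s n) (digit-1 (ss′ n) eq) sC≤C)

    large-digit : ∃ λ n → 2 ℕ.≤ κ n
    large-digit = some-large-digit (suc m) 0 (ℕ.+-identityʳ _) 0
      (≤-respˡ-≈ (*-comm _ _) (2s≤lam 0))

    -- The staircase bound a ≤ (lam - 1) b gives a new b of at least (lam + 1) b, while badness
    -- keeps it below b (2 + s′). This is how the point lam - 1 enters.
    after-large-digit : ∀ n → 2 ℕ.≤ κ n → lam + - 1# < s (suc n)
    after-large-digit n 2≤κ = *-cancelˡ-< (lam + - 1#) (s (suc n)) (inj₁ (0<b n))
      (<-by (+-pos-nonneg (x<y⇒0<y-x (bad (suc n)))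
              (+-nonneg (x≤y⇒0≤y-x (below-negative (0<s n) (below n)))
                (*-nonneg (x≤y⇒0≤y-x (ι-mono-≤ 2≤κ))
                          (*-nonneg (inj₁ 0<lam) (inj₁ (0<b n))))))
        (modulo (a′ n) (2# + s (suc n)) (modulo (b′ n) (- 1#)
          (solve 7 (λ l b a k s′ a′ b′ →
             b :* (l :- :1)
             :+ (a′ :* (:2 :+ s′) :- b′ :+ (((l :- :1) :* b :- a) :+ (k :- :2) :* (l :* b)))
             :+ (:2 :+ s′) :* b :+ (:- :1) :* (k :* l :* b :- a)
             := b :* s′ :+ (:2 :+ s′) :* a′ :+ (:- :1) :* b′)
            refl lam (b n) (a n) (ι (κ n)) (s (suc n)) (a (suc n)) (b (suc n))))))

    -- On the periodic orbit of 1 - lam one has s = E_{j+1} / E_j, hence z = 0;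
    -- the orbit at hand is repelled from it.
    z : ℕ → ℕ → Carrier
    z n j = s n * E j + - E (suc j)

    -- The window E_{j+1} / E_j < s ≤ C_{j+1} / C_j at phase j of the period.
    Repelled : ℕ → ℕ → Set
    Repelled n j = j ℕ.≤ m × s n * C j ≤ C (suc j) × 0# < z n j

    repelled-1 : ∀ n j → j ℕ.< m → s n * C j ≤ C (suc j) → 0# < z n j → κ n ≡ 1 →
                 Repelled (suc n) (suc j) × z n j ≈ s n * z (suc n) (suc j)
    repelled-1 n j j<m sC≤C 0<z κ≡1 =
      (j<m , C-forward j (0<s n) (digit-1 (ss′ n) κ≡1) sC≤C
      , *-cancelˡ-0< (inj₁ (0<s n)) (<-respʳ-≈ z≈sz′ 0<z))
      , z≈sz′
      where
      z≈sz′ : z n j ≈ s n * z (suc n) (suc j)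
      z≈sz′ = modulo (digit-1 (ss′ n) κ≡1) (- E (suc j))
        (solve 5 (λ s s′ l c c′ →
           let e = c :+ c′ ; c″ = l :* c′ :- c ; e′ = c′ :+ c″ ; e″ = c″ :+ (l :* c″ :- c′) in
           s :* e :- e′ :+ (:- e′) :* (l :* s :- :1)
           := s :* (s′ :* e′ :- e″) :+ (:- e′) :* (s :* s′))
          refl (s n) (s (suc n)) lam (C j) (C (suc j)))

    -- From s′ ≤ lam / 2 one gets (κ - ½) lam s ≤ 1, written here without fractions.
    digit-bound : ∀ n c → c ℕ.≤ κ n → 2# * ι c * (lam * s n) ≤ 2# + lam * s n
    digit-bound n c c≤κ = ≤-by
      (+-nonneg (*-nonneg (inj₁ 0<2) (*-nonneg (x≤y⇒0≤y-x (ι-mono-≤ c≤κ))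
                                       (*-nonneg (inj₁ 0<lam) (inj₁ (0<s n)))))
                (*-nonneg (inj₁ (0<s n)) (x≤y⇒0≤y-x (2s≤lam (suc n)))))
      (modulo (ss′ n) (- 2#)
        (solve 5 (λ s s′ l k c →
           :2 :* c :* (l :* s) :+ (:2 :* ((k :- c) :* (l :* s)) :+ s :* (l :- :2 :* s′))
           :+ (:- :2) :* (k :* l :* s :- :1)
           := :2 :+ l :* s :+ (:- :2) :* (s :* s′))
          refl (s n) (s (suc n)) lam (ι (κ n)) (ι c)))

    z-last : ∀ n → z n m ≈ Cₚ₋₁ * ((lam + 1#) * s n + - 1#)
    z-last n = modulo Eₘ≈ (s n) (modulo E-last (- 1#)
      (solve 5 (λ s l e e′ c →
         s :* e :- e′ :+ s :* ((l :+ :1) :* c) :+ (:- :1) :* c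
         := c :* ((l :+ :1) :* s :- :1) :+ s :* e :+ (:- :1) :* e′)
        refl (s n) lam (E m) (E (suc m)) Cₚ₋₁))

    1<ls+s : ∀ n → 0# < z n m → 1# < (lam + 1#) * s n
    1<ls+s n 0<z = <-by
      (*-cancelˡ-0< (inj₁ 0<Cₚ₋₁) (<-respʳ-≈ (z-last n) 0<z))
      (solve 1 (λ x → :1 :+ (x :- :1) := x) refl ((lam + 1#) * s n))

    ls≤1 : ∀ n → s n * C m ≤ Cₚ₋₁ → lam * s n ≤ 1#
    ls≤1 n sC≤C = *-cancelˡ-≤ _ _ 0<Cₚ₋₁ (≤-by (x≤y⇒0≤y-x sC≤C)
      (modulo C-last (- s n)
        (solve 4 (λ s l c c′ →
           c′ :* (l :* s) :+ (c′ :- s :* c) :+ (:- s) :* (l :* c′)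
           := c′ :* :1 :+ (:- s) :* c)
          refl (s n) lam (C m) Cₚ₋₁)))

    -- The window forces the digits of the extremal word. For j < m, lam s > lam E_{j+1} / E_j > 1,
    -- whereas a digit ≥ 2 needs 3 lam s ≤ 2. At j = m, lam s ≤ 1 excludes the digit 1, and (lam +
    -- 1) s > 1 excludes digits ≥ 3, which need 5 lam s ≤ 2.
    repelled-step : ∀ n j → Repelled n j →
                    ∃ λ j′ → Repelled (suc n) j′ × z n j ≤ s n * z (suc n) j′
    repelled-step n j (j≤m , sC≤C , 0<z) with ℕ.m≤n⇒m<n∨m≡n j≤m | κ n in eq
    ... | _        | zero     = contradiction eq (digit-nonzero (0<s n) (0<s (suc n)) (ss′ n))
    ... | inj₁ j<m | suc zero =
      let state , z≈sz′ = repelled-1 n j j<m sC≤C 0<z eq in suc j , state , inj₂ z≈sz′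
    ... | inj₁ j<m | suc (suc k) = contradiction
      (digit-bound n 2 (≡.subst (2 ℕ.≤_) (≡.sym eq) (ℕ.s≤s (ℕ.s≤s ℕ.z≤n))))
      (<⇒≱ (<-by (+-pos 0<1 (*-pos (ι-pos 2) 0<ls-1))
        (solve 1 (λ x → :2 :+ x :+ (:1 :+ con (+ 3) :* (x :- :1)) := :2 :* :2 :* x)
          refl (lam * s n))))
      where
      0<ls-1 : 0# < lam * s n + - 1#
      0<ls-1 = *-cancelˡ-0< (inj₁ (E-pos j (ℕ.m≤n⇒m≤1+n j≤m)))
        (<-respʳ-≈ (solve 4 (λ s l c c′ →
            let e = c :+ c′ ; c″ = l :* c′ :- c ; e′ = c′ :+ c″ ; e″ = c″ :+ (l :* c″ :- c′) in
            l :* (s :* e :- e′) :+ e″ := e :* (l :* s :- :1))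
            refl (s n) lam (C j) (C (suc j)))
          (+-pos (*-pos 0<lam 0<z) (E-pos (suc (suc j)) (ℕ.s≤s j<m))))
    ... | inj₂ ≡.refl | suc zero = contradiction
      (≤-by (x≤y⇒0≤y-x (ls≤1 n sC≤C))
        (modulo (digit-1 (ss′ n) eq) 1#
          (solve 3 (λ s s′ l →
             s :* s′ :+ (:1 :- l :* s) :+ :1 :* (l :* s :- :1) := :0 :+ :1 :* (s :* s′))
            refl (s n) (s (suc n)) lam)))
      (<⇒≱ (*-pos (0<s n) (0<s (suc n))))
    ... | inj₂ ≡.refl | suc (suc (suc k)) = contradiction
      (digit-bound n 3 (≡.subst (3 ℕ.≤_) (≡.sym eq) (ℕ.s≤s (ℕ.s≤s (ℕ.s≤s ℕ.z≤n)))))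
      (<⇒≱ (<-by (+-pos (+-pos (*-pos 0<2 (x<y⇒0<y-x (1<ls+s n 0<z)))
                               (*-pos 0<2 (*-pos (x<y⇒0<y-x 1<lam) (0<s n))))
                        (*-pos 0<lam (0<s n)))
        (solve 2 (λ l s →
           :2 :+ l :* s :+ (:2 :* ((l :+ :1) :* s :- :1) :+ :2 :* ((l :- :1) :* s) :+ l :* s)
           := :2 :* con (+ 3) :* (l :* s)) refl lam (s n))))
    ... | inj₂ ≡.refl | suc (suc zero) =
      0 , (ℕ.z≤n , ≤-respˡ-≈ (*-comm _ _) (2s≤lam (suc n))
        , *-cancelˡ-0< (inj₁ (0<s n)) (<-≤-trans 0<z z≤sz′)) , z≤sz′
      where
      -- With w = (lam + 1) s - 1 the two sides are C_{p-1} w and E_0 w.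
      z≤sz′ : z n m ≤ s n * z (suc n) 0
      z≤sz′ = ≤-by
        (*-nonneg (x≤y⇒0≤y-x (E≤E₀ (suc m) ℕ.≤-refl))
                  (inj₁ (x<y⇒0<y-x (1<ls+s n 0<z))))
        (modulo (z-last n) 1# (modulo E-last (- w) (modulo (digit-2 (ss′ n) eq) (- E 0)
          (solve 6 (λ s s′ l e zₙ c →
             let w = (l :+ :1) :* s :- :1 ; e₀ = :2 :+ l in
             zₙ :+ (e₀ :- e) :* w :+ :1 :* (c :* w) :+ :- w :* c
             :+ :- e₀ :* (:2 :* l :* s :- :1)
             := s :* (s′ :* e₀ :- (l :+ (l :* l :- :2))) :+ :1 :* zₙ :+ :- w :* e
                :+ :- e₀ :* (s :* s′))
            refl (s n) (s (suc n)) lam (E (suc m)) (z n m) Cₚ₋₁))))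
        where w = (lam + 1#) * s n + - 1#

    start : ∃ λ n → Repelled n 0
    start = let n , 2≤κ = large-digit in suc n
      , ℕ.z≤n
      , ≤-respˡ-≈ (*-comm _ _) (2s≤lam (suc n))
      , <-respʳ-≈
          (solve 2 (λ s l → (:2 :+ l) :* (s :- (l :- :1)) := s :* (:2 :+ l) :- (l :+ (l :* l :- :2)))
            refl (s (suc n)) lam)
          (*-pos (E-pos 0 ℕ.z≤n) (x<y⇒0<y-x (after-large-digit n 2≤κ)))

    n₀ = proj₁ start
    z₀ = z n₀ 0

    0<z₀ : 0# < z₀
    0<z₀ = proj₂ (proj₂ (proj₂ start))

    δ = (2# + - lam) * z₀

    0<δ : 0# < δ
    0<δ = *-pos 0<2-lam 0<z₀

    -- Since 2z ≤ 2s z′ ≤ lam z′, each step adds at least (2 - lam) z′ ≥ δ to 2z. Linear growth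
    -- already contradicts the bound `z≤E₀`.
    growth : ∀ k → ∃ λ j → Repelled (k ℕ.+ n₀) j × 2# * z₀ + ι k * δ ≤ 2# * z (k ℕ.+ n₀) j
    growth zero    = 0 , proj₂ start ,
      inj₂ (solve 2 (λ z d → :2 :* z :+ :0 :* d := :2 :* z) refl z₀ δ)
    growth (suc k) =
      let n = k ℕ.+ n₀
          j , state , bound = growth k
          j′ , state′ , z≤sz′ = repelled-step n j state
          0<z′   = proj₂ (proj₂ state′)
          z′     = z (suc n) j′
          z₀≤z   = *-cancelˡ-≤ z₀ (z n j) 0<2
                     (≤-trans (≤-by (*-nonneg (ι-nonneg k) (inj₁ 0<δ)) refl) bound)
          sz′≤z′ = ≤-by (*-nonneg (x≤y⇒0≤y-x (inj₁ (s<1 n))) (inj₁ 0<z′))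
                     (solve 2 (λ s z → s :* z :+ (:1 :- s) :* z := z) refl (s n) z′)
          z₀≤z′  = ≤-trans z₀≤z (≤-trans z≤sz′ sz′≤z′)
      in j′ , state′ , ≤-by
        (+-nonneg (+-nonneg (x≤y⇒0≤y-x bound)
                            (*-nonneg (inj₁ 0<2) (x≤y⇒0≤y-x z≤sz′)))
          (+-nonneg (*-nonneg (inj₁ 0<2-lam) (x≤y⇒0≤y-x z₀≤z′))
                    (*-nonneg (x≤y⇒0≤y-x (2s≤lam n)) (inj₁ 0<z′))))
        (solve 6 (λ l z₀ z z′ k s →
           let d = (:2 :- l) :* z₀ in
           :2 :* z₀ :+ (:1 :+ k) :* d
           :+ (((:2 :* z :- (:2 :* z₀ :+ k :* d)) :+ :2 :* (s :* z′ :- z))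
               :+ ((:2 :- l) :* (z′ :- z₀) :+ (l :- :2 :* s) :* z′))
           := :2 :* z′)
          refl lam z₀ (z n j) z′ (ι k) (s n))

    z≤E₀ : ∀ n j → Repelled n j → z n j ≤ E 0
    z≤E₀ n j (j≤m , _) = ≤-by
      (+-nonneg (+-nonneg (inj₁ (E-pos (suc j) (ℕ.s≤s j≤m)))
                  (*-nonneg (x≤y⇒0≤y-x (inj₁ (s<1 n))) (inj₁ (E-pos j j≤1+m))))
        (x≤y⇒0≤y-x (E≤E₀ j j≤1+m)))
      (solve 4 (λ s e e′ e₀ → s :* e :- e′ :+ (e′ :+ (:1 :- s) :* e :+ (e₀ :- e)) := e₀)
        refl (s n) (E j) (E (suc j)) (E 0))
      where j≤1+m = ℕ.m≤n⇒m≤1+n j≤m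

    impossible : ⊥
    impossible =
      let k , big           = archimedean (2# * E 0 / δ)
          j , state , bound = growth k
          2E₀<kδ = <-respˡ-≈ (*-/-cancel 0<δ (2# * E 0)) (*-monoˡ-< 0<δ big)
      in contradiction (*-monoˡ-≤ (inj₁ 0<2) (z≤E₀ (k ℕ.+ n₀) j state))
           (<⇒≱ (<-≤-trans
             (<-by (+-pos (x<y⇒0<y-x 2E₀<kδ) (*-pos 0<2 0<z₀))
               (solve 4 (λ e k d z → :2 :* e :+ (d :* k :- :2 :* e :+ :2 :* z) := :2 :* z :+ k :* d)
                 refl (E 0) (ι k) δ z₀))
             bound))

-- The Rosen map and its approximation coefficients.

module RosenMap (ℝ : CompleteOrderedField) (lam : CompleteOrderedField.Carrier ℝ)
  (0<lam : CompleteOrderedField._<_ ℝ (CompleteOrderedField.0# ℝ) lam)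
  where
  open CompleteOrderedField ℝ
  open Real ℝ
  open Rosen ℝ lam
  open IntegerCoefficients ℝ
  open OrderedField ℝ

  ⌊⌋-bounds : ∀ {x} → 0# ≤ x → ι ⌊ x ⌋ ≤ x × x < ι (suc ⌊ x ⌋)
  ⌊⌋-bounds {x} 0≤x with compare 0# x
  ... | tri< 0<x _ _ = proj₂ (floor-exists x (inj₁ 0<x))
  ... | tri≈ _ 0≈x _ = proj₂ (floor-exists x (inj₂ 0≈x))
  ... | tri> _ _ x<0 = contradiction 0≤x (<⇒≱ x<0)

  f≈ : ∀ {x} → ¬ x ≈ 0# → f x ≈ 1# / ∣ x ∣ + - (lam * ι (r x))
  f≈ {x} x≉0 with compare x 0# in eq
  ... | tri< _ _ _ rewrite eq = refl
  ... | tri≈ _ x≈0 _          = contradiction x≈0 x≉0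
  ... | tri> _ _ _ rewrite eq = refl

  f-equation : ∀ {x} → ¬ x ≈ 0# → ∣ x ∣ * (f x + lam * ι (r x)) ≈ 1#
  f-equation {x} x≉0 =
    *-congˡ (+-congʳ (f≈ x≉0)
             ⨾ solve 2 (λ y z → y :- z :+ z := y) refl (1# / ∣ x ∣) (lam * ι (r x)))
    ⨾ *-/-cancel (∣∣-pos x≉0) 1#

  -- `InInterval` multiplied by 2, so that certificates stay polynomial, without the inverse of 2.
  Centred : Carrier → Set
  Centred y = - lam ≤ 2# * y × 2# * y < lam

  2*lam/2≈lam : 2# * (lam / 2#) ≈ lam
  2*lam/2≈lam = *-/-cancel 0<2 lam

  interval⇒centred : ∀ {x} → InInterval x → Centred x
  interval⇒centred {x} (lo , hi) =
    ≤-respˡ-≈ (solve 2 (λ c h → c :* :- h := :- (c :* h)) refl 2# (lam / 2#) ⨾ -‿cong 2*lam/2≈lam)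
      (*-monoˡ-≤ (inj₁ 0<2) lo) ,
    <-respʳ-≈ 2*lam/2≈lam (*-monoˡ-< 0<2 hi)

  centred⇒interval : ∀ {x} → Centred x → InInterval x
  centred⇒interval {x} (lo , hi) =
    *-cancelˡ-≤ _ _ 0<2
      (≤-respˡ-≈ (-‿cong (sym 2*lam/2≈lam)
                  ⨾ solve 2 (λ c h → :- (c :* h) := c :* :- h) refl 2# (lam / 2#)) lo) ,
    *-cancelˡ-< _ _ (inj₁ 0<2) (<-respʳ-≈ (sym 2*lam/2≈lam) hi)

  f-centred : ∀ {x} → ¬ x ≈ 0# → Centred (f x)
  f-centred {x} x≉0 =
    ≤-by (*-nonneg (inj₁ 0<2lam) (x≤y⇒0≤y-x (proj₁ bounds)))
      (modulo 2*½≈1 lam (modulo 2f (- 1#)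
        (solve 5 (λ l k u h g →
           :- l :+ :2 :* l :* (u :+ h :- k) :+ l :* :1 :+ :- :1 :* (:2 :* (l :* u :- l :* k))
           := g :+ l :* (:2 :* h) :+ :- :1 :* g)
          refl lam (ι (r x)) u ½ (2# * f x)))) ,
    <-by (*-pos 0<2lam (x<y⇒0<y-x (proj₂ bounds)))
      (modulo 2*½≈1 (- lam) (modulo 2f 1#
        (solve 5 (λ l k u h g →
           g :+ :2 :* l :* (:1 :+ k :- (u :+ h)) :+ :- l :* :1 :+ :1 :* (:2 :* (l :* u :- l :* k))
           := l :+ :- l :* (:2 :* h) :+ :1 :* g)
          refl lam (ι (r x)) u ½ (2# * f x))))
    where
    0<∣x∣  = ∣∣-pos x≉0
    0<2lam = *-pos 0<2 0<lam
    u      = 1# / (lam * ∣ x ∣)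

    0<u : 0# < u
    0<u = *-pos 0<1 (⁻¹-pos (*-pos 0<lam 0<∣x∣))

    bounds = ⌊⌋-bounds (inj₁ (+-pos 0<u 0<½))

    1/∣x∣≈ : 1# / ∣ x ∣ ≈ lam * u
    1/∣x∣≈ = *-cancelˡ-≈ _ _ 0<∣x∣ (*-/-cancel 0<∣x∣ 1#
      ⨾ sym (*-/-cancel (*-pos 0<lam 0<∣x∣) 1#)
      ⨾ solve 3 (λ l a u → l :* a :* u := a :* (l :* u)) refl lam ∣ x ∣ u)

    2f : 2# * f x ≈ 2# * (lam * u + - (lam * ι (r x)))
    2f = *-congˡ (f≈ x≉0 ⨾ +-congʳ 1/∣x∣≈)

  private
    digit-≮ : ∀ {x y k l} → 0# < x → Centred y → ∀ {z} → Centred z →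
      x * (y + lam * ι k) ≈ 1# → x * (z + lam * ι l) ≈ 1# → ¬ k ℕ.< l
    digit-≮ {x} {y} {k} {l} 0<x (_ , y<) {z} (z≥ , _) eq eq′ k<l = <⇒≱
      (<-by (+-pos-nonneg
              (+-pos-nonneg (x<y⇒0<y-x y<) (x≤y⇒0≤y-x z≥))
              (*-nonneg (*-nonneg (inj₁ 0<2) (inj₁ 0<lam)) (x≤y⇒0≤y-x (ι-mono-≤ k<l))))
        (solve 5 (λ y z h k l →
           :2 :* (y :+ h :* k) :+ ((h :- :2 :* y) :+ (:2 :* z :- :- h) :+ :2 :* h :* (l :- (:1 :+ k)))
           := :2 :* (z :+ h :* l))
          refl y z lam (ι k) (ι l)))
      (inj₂ (*-congˡ (*-cancelˡ-≈ _ _ 0<x (eq′ ⨾ sym eq))))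

  digit-unique : ∀ {x y z k l} → 0# < x → Centred y → Centred z →
    x * (y + lam * ι k) ≈ 1# → x * (z + lam * ι l) ≈ 1# → k ≡ l
  digit-unique {k = k} {l} 0<x cy cz eq eq′ with ℕ.<-cmp k l
  ... | tri< k<l _ _ = contradiction k<l (digit-≮ {k = k} {l} 0<x cy cz eq eq′)
  ... | tri≈ _ k≡l _ = k≡l
  ... | tri> _ _ l<k = contradiction l<k (digit-≮ {k = l} {k} 0<x cz cy eq′ eq)

  -- The translates of a half-open interval of length lam by multiples of lam are disjoint. This
  -- evaluates `r` and `f` on the explicit orbit in `Extremal` without computing a floor.
  f-unique : ∀ {x y k} → ¬ x ≈ 0# → Centred y → ∣ x ∣ * (y + lam * ι k) ≈ 1# →
             r x ≡ k × f x ≈ y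
  f-unique {x} {y} {k} x≉0 cy eq =
    r≡k , cancel r≡k (*-cancelˡ-≈ _ _ (∣∣-pos x≉0) (f-equation x≉0 ⨾ sym eq))
    where
    r≡k : r x ≡ k
    r≡k = digit-unique {k = r x} {l = k} (∣∣-pos x≉0) (f-centred x≉0) cy (f-equation x≉0) eq

    cancel : ∀ {u v m n} → m ≡ n → u + lam * ι m ≈ v + lam * ι n → u ≈ v
    cancel {u} {v} {m} ≡.refl u+w≈v+w =
      modulo u+w≈v+w 1#
        (solve 3 (λ u v w → u :+ :1 :* (v :+ w) := v :+ :1 :* (u :+ w)) refl u v (lam * ι m))

  sgn*∣∣ : ∀ {x} → ¬ x ≈ 0# → sgn x * ∣ x ∣ ≈ x
  sgn*∣∣ {x} x≉0 with compare x 0#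
  ... | tri< _ _ _   = solve 1 (λ x → :- :1 :* :- x := x) refl x
  ... | tri≈ _ x≈0 _ = contradiction x≈0 x≉0
  ... | tri> _ _ _   = *-identityˡ x

  sgn-neg : ∀ {x} → x < 0# → sgn x ≈ - 1#
  sgn-neg {x} x<0 with compare x 0#
  ... | tri< _ _ _   = refl
  ... | tri≈ _ x≈0 _ = contradiction x<0 (irrefl x≈0)
  ... | tri> _ _ 0<x = contradiction x<0 (asym 0<x)

  sgn-pos : ∀ {x} → 0# < x → sgn x ≈ 1#
  sgn-pos {x} 0<x with compare x 0#
  ... | tri< x<0 _ _ = contradiction x<0 (asym 0<x)
  ... | tri≈ _ x≈0 _ = contradiction x≈0 (pos⇒≉0 0<x)
  ... | tri> _ _ _   = refl

  linear-recurrence : ∀ x k g s₁ s₀ r₁ r₀ →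
    x * (k * s₁ + g * s₀) + - (k * r₁ + g * r₀)
    ≈ k * (x * s₁ + - r₁) + g * (x * s₀ + - r₀)
  linear-recurrence = solve 7 (λ x k g s₁ s₀ r₁ r₀ →
      x :* (k :* s₁ :+ g :* s₀) :- (k :* r₁ :+ g :* r₀)
      := k :* (x :* s₁ :- r₁) :+ g :* (x :* s₀ :- r₀))
    refl

  -- g e₀ = g a (t₁ + k) e₀ = t₀ e₀ (t₁ + k) = - e₁ (t₁ + k), and k e₁ cancels.
  error-step : ∀ {e₀ e₁ a k g t₀ t₁} → a * (t₁ + k) ≈ 1# → g * a ≈ t₀ →
    e₁ ≈ - (e₀ * t₀) → k * e₁ + g * e₀ ≈ - (e₁ * t₁)
  error-step {e₀} {e₁} {a} {k} {g} {t₀} {t₁} aT ga e₁≈ =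
    modulo aT (- (g * e₀)) (modulo ga (e₀ * (t₁ + k)) (modulo e₁≈ (t₁ + k)
      (solve 7 (λ e₁ e₀ k g t₀ t₁ a →
         let T = t₁ :+ k in
         k :* e₁ :+ g :* e₀ :+ :- (g :* e₀) :* :1 :+ e₀ :* T :* t₀ :+ T :* :- (e₀ :* t₀)
         := :- (e₁ :* t₁) :+ :- (g :* e₀) :* (a :* T) :+ e₀ :* T :* (g :* a) :+ T :* e₁)
        refl e₁ e₀ k g t₀ t₁ a)))

  norm-step : ∀ {s₀ s₁ A a k g t₀ t₁} → a * (t₁ + k) ≈ 1# → g * a ≈ t₀ →
    A * (s₁ + s₀ * t₀) ≈ 1# → A * a * (k * s₁ + g * s₀ + s₁ * t₁) ≈ 1#
  norm-step {s₀} {s₁} {A} {a} {k} {g} {t₀} {t₁} aT ga norm =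
    modulo aT (A * s₁) (modulo ga (A * s₀) (modulo norm 1#
      (solve 8 (λ s₁ s₀ k g t₀ t₁ a A →
         A :* a :* (k :* s₁ :+ g :* s₀ :+ s₁ :* t₁)
         :+ A :* s₁ :* :1 :+ A :* s₀ :* t₀ :+ :1 :* :1
         := :1 :+ A :* s₁ :* (a :* (t₁ :+ k)) :+ A :* s₀ :* (g :* a)
            :+ :1 :* (A :* (s₁ :+ s₀ :* t₀)))
        refl s₁ s₀ k g t₀ t₁ a A)))

  module Approximation (x : Carrier) (irrational : Irrational x) where

    t : ℕ → Carrier
    t n = f^ n x

    t≉0 : ∀ n → ¬ t n ≈ 0#
    t≉0 n t≈0 = irrational (n , t≈0)

    e : ℕ → Carrier
    e n = x * S⁺ x n + - R⁺ x n

    t-equation : ∀ n → ∣ t n ∣ * (t (suc n) + rᵈ x n * lam) ≈ 1#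
    t-equation n = *-congˡ (+-congˡ (*-comm _ _)) ⨾ f-equation (t≉0 n)

    e-recurrence : ∀ n → e (suc (suc n)) ≈ rᵈ x n * lam * e (suc n) + εᵈ x n * e n
    e-recurrence n = linear-recurrence x (rᵈ x n * lam) (εᵈ x n) _ _ _ _

    e-step : ∀ n → e (suc n) ≈ - (e n * t n)
    e-step zero    =
      solve 1 (λ x → x :* :1 :- :0 := :- ((x :* :0 :- :1) :* x)) refl x
    e-step (suc n) = e-recurrence n ⨾
      error-step (t-equation n) (sgn*∣∣ (t≉0 n)) (e-step n)

    ∣e∣-step : ∀ n → ∣ e (suc n) ∣ ≈ ∣ e n ∣ * ∣ t n ∣
    ∣e∣-step n = ∣∣-cong (e-step n) ⨾ ∣-x∣≈∣x∣ _ ⨾ ∣x*y∣≈∣x∣*∣y∣ _ _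

    -- Yields Θ_{n-1} = S_{n-1} / (S_n + S_{n-1} t_n). Each step multiplies the first factor by ∣
    -- t_n ∣ and divides the second by it, so the determinant of the convergents is bypassed.
    ∣e∣-equation : ∀ n → ∣ e n ∣ * (S⁺ x (suc n) + S⁺ x n * t n) ≈ 1#
    ∣e∣-equation zero =
      *-congʳ (∣∣-cong (solve 1 (λ x → x :* :0 :- :1 := :- :1) refl x) ⨾ ∣-x∣≈∣x∣ 1#
               ⨾ ∣∣-nonneg (inj₁ 0<1))
      ⨾ solve 1 (λ t → :1 :* (:1 :+ :0 :* t) := :1) refl x
    ∣e∣-equation (suc n) = *-congʳ (∣e∣-step n) ⨾
      norm-step (t-equation n) (sgn*∣∣ (t≉0 n)) (∣e∣-equation n)

    Θ≈ : ∀ n → 0# < S x n → Θ x n ≈ S x n * ∣ e (suc n) ∣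
    Θ≈ n 0<S = *-assoc (S x n) (S x n) ∣ y ∣
      ⨾ *-congˡ (sym (∣x*y∣≈x*∣y∣ (inj₁ 0<S) y) ⨾ ∣∣-cong
          (modulo (*-/-cancel 0<S (R x n)) (- 1#)
            (solve 4 (λ x s q r → s :* (x :- q) :+ (:- :1) :* r := x :* s :- r :+ (:- :1) :* (s :* q))
              refl x (S x n) (R x n / S x n) (R x n))))
      where y = x + - (R x n / S x n)

    Θ-upper : ∀ n c → 0# < S x n → S x n ≤ c * (S x (suc n) + S x n * t (suc n)) → Θ x n ≤ c
    Θ-upper n c 0<S S≤ = ≤-respˡ-≈ (sym (Θ≈ n 0<S ⨾ *-comm _ _))
      (≤-respʳ-≈ (modulo (∣e∣-equation (suc n)) c
          (solve 3 (λ e c w → e :* (c :* w) :+ c :* :1 := c :+ c :* (e :* w))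
            refl ∣ e (suc n) ∣ c (S x (suc n) + S x n * t (suc n))))
        (*-monoˡ-≤ (0≤∣x∣ (e (suc n))) S≤))

    Θ-lower : ∀ n c → 0# < S x n → c * (S x (suc n) + S x n * t (suc n)) < S x n → c < Θ x n
    Θ-lower n c 0<S <S = <-respʳ-≈ (sym (Θ≈ n 0<S ⨾ *-comm _ _))
      (<-respˡ-≈ (modulo (∣e∣-equation (suc n)) c
          (solve 3 (λ e c w → e :* (c :* w) :+ c :* :1 := c :+ c :* (e :* w))
            refl ∣ e (suc n) ∣ c (S x (suc n) + S x n * t (suc n))))
        (*-monoˡ-< 0<∣e∣ <S))
      where
      0<∣e∣ : 0# < ∣ e (suc n) ∣
      0<∣e∣ = ∣∣-pos λ e≈0 → irrefl
        (sym (zeroˡ _) ⨾ *-congʳ (sym (∣∣-cong e≈0 ⨾ ∣∣-nonneg ≤-refl)) ⨾ ∣e∣-equation (suc n)) 0<1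

-- The upper bound: 1/2 is an approximation constant.

module HurwitzBound (ℝ : CompleteOrderedField) (lam : CompleteOrderedField.Carrier ℝ) (m : ℕ)
  (C-pos  : ∀ j → j ℕ.≤ suc m →
            CompleteOrderedField._<_ ℝ (CompleteOrderedField.0# ℝ) (Chebyshev.C ℝ lam j))
  (C-zero : CompleteOrderedField._≈_ ℝ (Chebyshev.C ℝ lam (suc (suc m)))
            (CompleteOrderedField.0# ℝ))
  where
  open CompleteOrderedField ℝ
  open Real ℝ
  open Rosen ℝ lam
  open IntegerCoefficients ℝ
  open OrderedField ℝ
  open Chebyshev ℝ lam
  open Hecke ℝ lam m C-pos C-zero
  open RosenMap ℝ lam 0<lam

  digit-positive : ∀ {a t′} k → 0# < a → 2# * a ≤ lam → 2# * t′ < lam →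
                   a * (t′ + ι k * lam) ≈ 1# → ¬ k ≡ 0
  digit-positive {a} {t′} k 0<a 2a≤lam 2t′<lam eq ≡.refl = <⇒≱
    (<-by (+-pos (*-pos 0<a (x<y⇒0<y-x t′<1)) (x<y⇒0<y-x a<1))
      (modulo eq (- 1#)
        (solve 3 (λ a t l →
           :1 :+ (a :* (:1 :- t) :+ (:1 :- a)) :+ :- :1 :* :1
           := :1 :+ :- :1 :* (a :* (t :+ :0 :* l)))
          refl a t′ lam)))
    ≤-refl
    where
    below-1 : ∀ {y} → 2# * y < 2# → y < 1#
    below-1 2y<2 = *-cancelˡ-< _ 1# (inj₁ 0<2) (<-respʳ-≈ (sym (*-identityʳ 2#)) 2y<2)
    a<1  = below-1 (≤-<-trans 2a≤lam lam<2)
    t′<1 = below-1 (<-trans 2t′<lam lam<2)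

  negative-orbit : ∀ {t t′ A} k → A ≈ - t → A * (t′ + k * lam) ≈ 1# →
                   - t * - t′ ≈ k * lam * - t + - 1#
  negative-orbit {t} {t′} {A} k A≈ eq = modulo A≈ (t′ + k * lam) (modulo eq (- 1#)
    (solve 5 (λ t t′ A k l →
       :- t :* :- t′ :+ (t′ :+ k :* l) :* (:- t) :+ :- :1 :* :1
       := k :* l :* :- t :- :1 :+ (t′ :+ k :* l) :* A :+ :- :1 :* (A :* (t′ :+ k :* l)))
      refl t t′ A k lam))

  positive-orbit : ∀ {t t′ A} k → A ≈ t → A * (t′ + k * lam) ≈ 1# →
                   t * - t′ ≈ k * lam * t + - 1#
  positive-orbit {t} {t′} {A} k A≈ eq = modulo A≈ (t′ + k * lam) (modulo eq (- 1#)
    (solve 5 (λ t t′ A k l →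
       t :* :- t′ :+ (t′ :+ k :* l) :* t :+ :- :1 :* :1
       := k :* l :* t :- :1 :+ (t′ :+ k :* l) :* A :+ :- :1 :* (A :* (t′ :+ k :* l)))
      refl t t′ A k lam))

  centred⇒2-x≤lam : ∀ {t} → Centred t → 2# * - t ≤ lam
  centred⇒2-x≤lam {t} (lo , _) = ≤-by (x≤y⇒0≤y-x lo)
    (solve 2 (λ t l → :2 :* :- t :+ (:2 :* t :- :- l) := l) refl t lam)

  centred⇒2∣x∣≤lam : ∀ {t} → Centred t → 2# * ∣ t ∣ ≤ lam
  centred⇒2∣x∣≤lam {t} c with ≤⊎> 0# t
  ... | inj₁ 0≤t = ≤-respˡ-≈ (*-congˡ (sym (∣∣-nonneg 0≤t))) (inj₁ (proj₂ c))
  ... | inj₂ t<0 = ≤-respˡ-≈ (*-congˡ (sym (∣∣-nonpos (inj₁ t<0)))) (centred⇒2-x≤lam c)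

  -- With w = b / a this is AM-HM: w + t < 2 and 1/w + 1/t < 2 are incompatible.
  bad-positive-impossible : ∀ {a b b′ t t′ k} → 0# < a → 0# < b → 0# < t →
    t * - t′ ≈ k * t + - 1# → b′ ≈ k * b + a →
    b + a * t < 2# * a → ¬ b′ + b * t′ < 2# * b
  bad-positive-impossible {a} {b} {b′} {t} {t′} {k} 0<a 0<b 0<t tt′ b′≈ bad bad′ =
    <⇒≱ 0<-square (square-nonneg (b + - (a * t)))
    where
    w = b + a * t
    -- The two recurrences give t (b′ + b t′) = b + a t, so the second badness, multiplied by t, is
    -- this bound.
    w<2bt : w < 2# * b * t
    w<2bt = <-by (*-pos 0<t (x<y⇒0<y-x bad′))
      (modulo b′≈ (- t) (modulo tt′ b
        (solve 6 (λ a b b′ t t′ k →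
           b :+ a :* t :+ t :* (:2 :* b :- (b′ :+ b :* t′)) :+ :- t :* (k :* b :+ a)
           :+ b :* (k :* t :- :1)
           := :2 :* b :* t :+ :- t :* b′ :+ b :* (t :* :- t′))
          refl a b b′ t t′ k)))
    -- The square is w² - 4abt, and w² < 2aw < 4abt.
    0<-square : (b + - (a * t)) * (b + - (a * t)) < 0#
    0<-square = <-by
      (+-pos (*-pos (*-pos 0<2 0<a) (x<y⇒0<y-x w<2bt))
             (*-pos (+-pos 0<b (*-pos 0<a 0<t)) (x<y⇒0<y-x bad)))
      (solve 3 (λ a b t →
         let w = b :+ a :* t in
         (b :- a :* t) :* (b :- a :* t)
         :+ (:2 :* a :* (:2 :* b :* t :- w) :+ w :* (:2 :* a :- w)) := :0)
        refl a b t)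

  module Orbit (x : Carrier) (x∈I : InInterval x) (irrational : Irrational x) where
    open Approximation x irrational public

    t-centred : ∀ n → Centred (t n)
    t-centred zero    = interval⇒centred x∈I
    t-centred (suc n) = f-centred (t≉0 n)

    κ : ℕ → ℕ
    κ n = r (t n)

    κ≢0 : ∀ n → ¬ κ n ≡ 0
    κ≢0 n = digit-positive (κ n) (∣∣-pos (t≉0 n)) (centred⇒2∣x∣≤lam (t-centred n))
              (proj₂ (t-centred (suc n))) (t-equation n)

    State : ℕ → Set
    State n = 0# ≤ S⁺ x n × 0# < S⁺ x (suc n) × Below (S⁺ x n) (S⁺ x (suc n)) (- t n)

    S⁺-negative : ∀ n → t n < 0# →
      S⁺ x (suc (suc n)) ≈ ι (κ n) * lam * S⁺ x (suc n) + - S⁺ x n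
    S⁺-negative n t<0 = +-congˡ (*-congʳ (sgn-neg t<0)
      ⨾ solve 1 (λ a → :- :1 :* a := :- a) refl (S⁺ x n))

    S⁺-positive : ∀ n → 0# < t n →
      S⁺ x (suc (suc n)) ≈ ι (κ n) * lam * S⁺ x (suc n) + S⁺ x n
    S⁺-positive n 0<t = +-congˡ (*-congʳ (sgn-pos 0<t) ⨾ *-identityˡ _)

    negative-equation : ∀ n → t n < 0# →
      - t n * - t (suc n) ≈ ι (κ n) * lam * - t n + - 1#
    negative-equation n t<0 =
      negative-orbit (ι (κ n)) (∣∣-nonpos (inj₁ t<0)) (t-equation n)

    positive-equation : ∀ n → 0# < t n →
      t n * - t (suc n) ≈ ι (κ n) * lam * t n + - 1#
    positive-equation n 0<t =
      positive-orbit (ι (κ n)) (∣∣-nonneg (inj₁ 0<t)) (t-equation n)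

    state : ∀ n → State n
    state zero    = ≤-refl , 0<1 , below-start (- x)
    state (suc n) = step (state n) (compare (t n) 0#)
      where
      step : State n → _ → State (suc n)
      step (0≤a , 0<b , below) (tri< t<0 _ _) =
        inj₁ 0<b ,
        <-respʳ-≈ (sym (S⁺-negative n t<0)) (negative-step-pos (κ n) (κ≢0 n) 0<b (0<-x t<0) below) ,
        below-cong (sym (S⁺-negative n t<0))
          (negative-step (κ n) (κ≢0 n) 0<b (0<-x t<0) (centred⇒2-x≤lam (t-centred n))
            (negative-equation n t<0) below)
      step _ (tri≈ _ t≈0 _) = contradiction t≈0 (t≉0 n)
      step (0≤a , 0<b , below) (tri> _ _ 0<t) =
        inj₁ 0<b ,
        <-respʳ-≈ (sym (S⁺-positive n 0<t))
          (positive-step-pos (κ n) (κ≢0 n) 0≤a 0<b) ,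
        below-cong (sym (S⁺-positive n 0<t))
          (positive-step (κ n) (κ≢0 n) 0≤a 0<b 0<t (inj₁ (proj₂ (t-centred n)))
            (positive-equation n 0<t))

    Bad : ℕ → Set
    Bad n = S⁺ x (suc n) + S⁺ x n * t n < 2# * S⁺ x n

    S-pos : ∀ n → 0# < S x n
    S-pos n = proj₁ (proj₂ (state n))

    Θ>½⇒bad : ∀ n → ¬ Θ x n ≤ ½ → Bad (suc n)
    Θ>½⇒bad n Θ≰½ = ≰⇒> λ 2S≤w → Θ≰½ (Θ-upper n ½ (S-pos n)
      (≤-respˡ-≈ (½*2≈ (S x n)) (*-monoˡ-≤ (inj₁ 0<½) 2S≤w)))
      where
      ½*2≈ : ∀ y → ½ * (2# * y) ≈ y
      ½*2≈ y = modulo 2*½≈1 y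
        (solve 2 (λ h y → h :* (:2 :* y) :+ y :* :1 := y :+ y :* (:2 :* h)) refl ½ y)

    bad⇒negative : ∀ n → Bad (suc n) → Bad (suc (suc n)) → t (suc n) < 0#
    bad⇒negative n bad bad′ = ≰⇒> nonneg-impossible
      where
      nonneg-impossible : ¬ 0# ≤ t (suc n)
      nonneg-impossible (inj₂ 0≈t) = t≉0 (suc n) (sym 0≈t)
      nonneg-impossible (inj₁ 0<t) =
        bad-positive-impossible (S-pos n) (S-pos (suc n)) 0<t
          (positive-equation (suc n) 0<t) (S⁺-positive (suc n) 0<t) bad bad′

    bad-somewhere-fails : ∀ N → ¬ (∀ n → N ℕ.≤ n → Bad (suc n))
    bad-somewhere-fails N bad = NoBadOrbit.impossible
      (λ n → - t (n ℕ.+ suc N)) (λ n → S⁺ x (n ℕ.+ suc N)) (λ n → S⁺ x (suc (n ℕ.+ suc N)))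
      (λ n → κ (n ℕ.+ suc N))
      (λ n → 0<-x (negative n))
      (λ n → centred⇒2-x≤lam (t-centred (n ℕ.+ suc N)))
      (λ n → negative-equation (n ℕ.+ suc N) (negative n))
      (λ n → refl)
      (λ n → S⁺-negative (n ℕ.+ suc N) (negative n))
      (λ n → proj₁ (proj₂ (state (n ℕ.+ suc N))))
      (λ n → proj₂ (proj₂ (state (n ℕ.+ suc N))))
      (λ n → <-by (x<y⇒0<y-x (bad′ n))
        (solve 3 (λ a b t → b :+ (:2 :* a :- (b :+ a :* t)) := a :* (:2 :- t))
          refl (S⁺ x (n ℕ.+ suc N)) (S⁺ x (suc (n ℕ.+ suc N))) (t (n ℕ.+ suc N))))
      where
      bad′ : ∀ n → Bad (n ℕ.+ suc N)
      bad′ n = ≡.subst Bad (≡.sym (ℕ.+-suc n N)) (bad (n ℕ.+ N) (ℕ.m≤n+m N n))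

      negative : ∀ n → t (n ℕ.+ suc N) < 0#
      negative n = ≡.subst (λ k → t k < 0#) (≡.sym (ℕ.+-suc n N))
        (bad⇒negative (n ℕ.+ N) (bad (n ℕ.+ N) (ℕ.m≤n+m N n))
          (bad (suc (n ℕ.+ N)) (ℕ.m≤n⇒m≤1+n (ℕ.m≤n+m N n))))

  upper : IsApproximationConstant ½
  upper x x∈I irrational N with excluded-middle (∃ λ n → N ℕ.≤ n × Θ x n ≤ ½)
  ... | yes found  = found
  ... | no  ¬found = contradiction
    (λ n N≤n → Θ>½⇒bad n λ Θ≤½ → ¬found (n , N≤n , Θ≤½)) (bad-somewhere-fails N)
    where open Orbit x x∈I irrational

-- Optimality: the orbit of 1 - lam.

module Extremal (ℝ : CompleteOrderedField) (lam : CompleteOrderedField.Carrier ℝ) (m : ℕ)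
  (C-pos  : ∀ j → j ℕ.≤ suc m →
            CompleteOrderedField._<_ ℝ (CompleteOrderedField.0# ℝ) (Chebyshev.C ℝ lam j))
  (C-zero : CompleteOrderedField._≈_ ℝ (Chebyshev.C ℝ lam (suc (suc m)))
            (CompleteOrderedField.0# ℝ))
  where
  open CompleteOrderedField ℝ
  open Real ℝ
  open Rosen ℝ lam
  open IntegerCoefficients ℝ
  open OrderedField ℝ
  open Chebyshev ℝ lam
  open Hecke ℝ lam m C-pos C-zero
  open RosenMap ℝ lam 0<lam

  ρ : ℕ → Carrier
  ρ j = E (suc j) / E j

  E*ρ : ∀ j → j ℕ.≤ suc m → E j * ρ j ≈ E (suc j)
  E*ρ j j≤1+m = *-/-cancel (E-pos j j≤1+m) (E (suc j))

  ρ-pos : ∀ j → j ℕ.≤ m → 0# < ρ j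
  ρ-pos j j≤m = *-pos (E-pos (suc j) (ℕ.s≤s j≤m)) (⁻¹-pos (E-pos j (ℕ.m≤n⇒m≤1+n j≤m)))

  2ρ≤lam : ∀ j → j ℕ.≤ m → 2# * ρ j ≤ lam
  2ρ≤lam j j≤m = *-cancelˡ-≤ _ _ (E-pos j j≤1+m)
    (≤-by (x≤y⇒0≤y-x (2Eₛ≤lamE j j≤1+m))
      (modulo (E*ρ j j≤1+m) 2#
        (solve 4 (λ e e′ l r → e :* (:2 :* r) :+ (l :* e :- :2 :* e′) :+ :2 :* e′
                              := e :* l :+ :2 :* (e :* r))
          refl (E j) (E (suc j)) lam (ρ j))))
    where j≤1+m = ℕ.m≤n⇒m≤1+n j≤m

  -ρ-centred : ∀ j → j ℕ.≤ m → Centred (- ρ j)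
  -ρ-centred j j≤m =
    ≤-by (x≤y⇒0≤y-x (2ρ≤lam j j≤m))
      (solve 2 (λ r l → :- l :+ (l :- :2 :* r) := :2 :* :- r) refl (ρ j) lam) ,
    <-by (+-pos 0<lam (*-pos 0<2 (ρ-pos j j≤m)))
      (solve 2 (λ r l → :2 :* :- r :+ (l :+ :2 :* r) := l) refl (ρ j) lam)

  ρ-inner : ∀ j → j ℕ.< m → ρ j * (- ρ (suc j) + lam * ι 1) ≈ 1#
  ρ-inner j j<m = *-cancelˡ-≈ _ _ (E-pos j j≤1+m)
    (modulo (E*ρ j j≤1+m) (- ρ (suc j) + lam) (modulo (E*ρ (suc j) (ℕ.s≤s (ℕ.<⇒≤ j<m))) (- 1#)
      (solve 5 (λ c c′ l r r′ →
         let e = c :+ c′ ; c″ = l :* c′ :- c ; e′ = c′ :+ c″ ; e″ = c″ :+ (l :* c″ :- c′) in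
         e :* (r :* (:- r′ :+ l :* (:1 :+ :0))) :+ (:- r′ :+ l) :* e′ :+ :- :1 :* e″
         := e :* :1 :+ (:- r′ :+ l) :* (e :* r) :+ :- :1 :* (e′ :* r′))
        refl (C j) (C (suc j)) lam (ρ j) (ρ (suc j)))))
    where j≤1+m = ℕ.<⇒≤ (ℕ.m≤n⇒m≤1+n j<m)

  ρ₀≈ : ρ 0 ≈ lam + - 1#
  ρ₀≈ = *-cancelˡ-≈ _ _ (E-pos 0 ℕ.z≤n) (E*ρ 0 ℕ.z≤n ⨾ E₁≈ ⨾ *-comm _ _)

  -- C_p = 0 makes ρ_m = E_{p-1} / E_{p-2} equal to 1 / (lam + 1), and 2 lam - ρ_0 = lam + 1: the
  -- digit 2 closes the period.
  ρ-wrap : ρ m * (- ρ 0 + lam * ι 2) ≈ 1#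
  ρ-wrap = *-cancelˡ-≈ _ _ 0<Cₚ₋₁
    (modulo ρ₀≈ (- (Cₚ₋₁ * ρ m)) (modulo Eₘ≈ (- ρ m) (modulo E-last 1# (modulo (E*ρ m (ℕ.n≤1+n m)) 1#
      (solve 6 (λ c l r r₀ e e′ →
         c :* (r :* (:- r₀ :+ l :* :2)) :+ :- (c :* r) :* (l :- :1) :+ :- r :* ((l :+ :1) :* c)
         :+ :1 :* c :+ :1 :* e′
         := c :* :1 :+ :- (c :* r) :* r₀ :+ :- r :* e :+ :1 :* e′ :+ :1 :* (e :* r))
        refl Cₚ₋₁ lam (ρ m) (ρ 0) (E m) (E (suc m)))))))

  f-at-ρ : ∀ {y y′ k} j → j ℕ.≤ m → y ≈ - ρ j → Centred y′ → ρ j * (y′ + lam * ι k) ≈ 1# →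
           y < 0# × r y ≡ k × f y ≈ y′
  f-at-ρ {y} j j≤m y≈ centred eq =
    y<0 , f-unique y≉0 centred (*-congʳ ∣y∣≈ρ ⨾ eq)
    where
    y<0  = <-by (ρ-pos j j≤m) (+-congʳ y≈ ⨾ -‿inverseˡ (ρ j))
    y≉0 : ¬ y ≈ 0#
    y≉0 y≈0 = irrefl y≈0 y<0
    ∣y∣≈ρ = ∣∣-nonpos (inj₁ y<0) ⨾ -‿cong y≈ ⨾ solve 1 (λ r → :- (:- r) := r) refl (ρ j)

  -- The conserved determinant of (S_{n-1} , S_n) against the attracting
  -- direction (D_j , D_{j+1}).
  K : ℕ → Carrier → Carrier → Carrier
  K j a b = D j * b + - (a * D (suc j))

  K-inner : ∀ j a b → K (suc j) b (ι 1 * lam * b + - a) ≈ K j a b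
  K-inner j a b = solve 5 (λ c c′ l a b →
    let d = c :- c′ ; c″ = l :* c′ :- c ; d′ = c′ :- c″ ; d″ = c″ :- (l :* c″ :- c′) in
    d′ :* ((:1 :+ :0) :* l :* b :- a) :- b :* d″ := d :* b :- a :* d′)
    refl (C j) (C (suc j)) lam a b

  -- The digit 2 scales K by D_0 / C_{p-1} ≤ 1 and the digits 1 preserve it, so K stays between 0
  -- and its initial value D_0.
  K-wrap : ∀ a b → Cₚ₋₁ * K 0 b (ι 2 * lam * b + - a) ≈ D 0 * K m a b
  K-wrap a b = modulo Dₘ≈ (- (D 0 * b)) (modulo D-last (D 0 * a)
    (solve 6 (λ c l a b d d′ →
       let d₀ = :2 :- l ; d₁ = l :- (l :* l :- :2) in
       c :* (d₀ :* (:2 :* l :* b :- a) :- b :* d₁) :+ :- (d₀ :* b) :* ((l :- :1) :* c) :+ d₀ :* a :* c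
       := d₀ :* (d :* b :- a :* d′) :+ :- (d₀ :* b) :* d :+ d₀ :* a :* d′)
      refl Cₚ₋₁ lam a b (D m) (D (suc m))))

  K-pos⇒ : ∀ {j a b} → j ℕ.≤ m → 0# < a → 0# ≤ K j a b → 0# < b
  K-pos⇒ {j} {a} {b} j≤m 0<a 0≤K =
    *-cancelˡ-0< (inj₁ (D-pos j (ℕ.m≤n⇒m≤1+n (ℕ.m≤n⇒m≤1+n j≤m))))
    (<-respʳ-≈ (solve 4 (λ a b d d′ → d :* b :- a :* d′ :+ a :* d′ := d :* b)
                 refl a b (D j) (D (suc j)))
      (+-nonneg-pos 0≤K (*-pos 0<a (D-pos (suc j) (ℕ.s≤s (ℕ.m≤n⇒m≤1+n j≤m))))))

  x₀ : Carrier
  x₀ = 1# + - lam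

  x₀≈ : x₀ ≈ - ρ 0
  x₀≈ = modulo ρ₀≈ 1#
    (solve 2 (λ l r → :1 :- l :+ :1 :* (l :- :1) := :- r :+ :1 :* r) refl lam (ρ 0))

  Tracked : ℕ → Set
  Tracked n = ∃ λ j → j ℕ.≤ m × f^ n x₀ ≈ - ρ j × 0# ≤ S⁺ x₀ n × 0# < S⁺ x₀ (suc n) ×
                      0# ≤ K j (S⁺ x₀ n) (S⁺ x₀ (suc n)) × K j (S⁺ x₀ n) (S⁺ x₀ (suc n)) ≤ D 0

  S⁺-next : ∀ n k → f^ n x₀ < 0# → r (f^ n x₀) ≡ k →
            S⁺ x₀ (suc (suc n)) ≈ ι k * lam * S⁺ x₀ (suc n) + - S⁺ x₀ n
  S⁺-next n k t<0 r≡k = +-cong (reflexive (≡.cong (λ k → ι k * lam * S⁺ x₀ (suc n)) r≡k))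
    (*-congʳ (sgn-neg t<0) ⨾ solve 1 (λ a → :- :1 :* a := :- a) refl (S⁺ x₀ n))

  K-cong : ∀ j {a b b′} → b ≈ b′ → K j a b ≈ K j a b′
  K-cong j b≈b′ = +-congʳ (*-congˡ b≈b′)

  tracked : ∀ n → Tracked n
  tracked zero    = 0 , ℕ.z≤n , x₀≈ , ≤-refl , 0<1 ,
    ≤-respʳ-≈ (sym K₀≈) (inj₁ 0<D₀) , inj₂ K₀≈
    where
    K₀≈ : K 0 0# 1# ≈ D 0
    K₀≈ = solve 2 (λ d d′ → d :* :1 :- :0 :* d′ := d) refl (D 0) (D 1)
  tracked (suc n) = step (tracked n)
    where
    a = S⁺ x₀ n
    b = S⁺ x₀ (suc n)

    build : ∀ j → j ℕ.≤ m → f^ (suc n) x₀ ≈ - ρ j → 0# < b → ∀ k → f^ n x₀ < 0# →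
            r (f^ n x₀) ≡ k → 0# ≤ K j b (ι k * lam * b + - a) →
            K j b (ι k * lam * b + - a) ≤ D 0 → Tracked (suc n)
    build j j≤m f≈ 0<b k t<0 r≡k 0≤K K≤ = j , j≤m , f≈ , inj₁ 0<b ,
      K-pos⇒ j≤m 0<b 0≤K′ , 0≤K′ , ≤-respˡ-≈ K≈ K≤
      where
      K≈  = K-cong j (sym (S⁺-next n k t<0 r≡k))
      0≤K′ = ≤-respʳ-≈ K≈ 0≤K

    step : Tracked n → Tracked (suc n)
    step (j , j≤m , t≈ , 0≤a , 0<b , 0≤K , K≤) with ℕ.m≤n⇒m<n∨m≡n j≤m
    ... | inj₁ j<m =
      let t<0 , r≡ , f≈ = f-at-ρ {k = 1} j j≤m t≈ (-ρ-centred (suc j) j<m) (ρ-inner j j<m) in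
      build (suc j) j<m f≈ 0<b 1 t<0 r≡
        (≤-respʳ-≈ (sym (K-inner j a b)) 0≤K) (≤-respˡ-≈ (sym (K-inner j a b)) K≤)
    ... | inj₂ ≡.refl =
      let t<0 , r≡ , f≈ = f-at-ρ {k = 2} m j≤m t≈ (-ρ-centred 0 ℕ.z≤n) ρ-wrap in
      build 0 ℕ.z≤n f≈ 0<b 2 t<0 r≡
        (*-cancelˡ-≤ _ _ 0<Cₚ₋₁ (≤-respʳ-≈ (sym (K-wrap a b)) (≤-respˡ-≈ (sym (zeroʳ Cₚ₋₁))
          (*-nonneg (inj₁ 0<D₀) 0≤K))))
        (*-cancelˡ-≤ _ _ 0<Cₚ₋₁ (≤-respˡ-≈ (sym (K-wrap a b)) (≤-respʳ-≈ (*-comm _ _)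
          (*-monoˡ-≤ (inj₁ 0<D₀) (≤-trans K≤ D₀≤Cₚ₋₁)))))

  x₀-irrational : Irrational x₀
  x₀-irrational (n , t≈0) = let j , j≤m , t≈ , _ = tracked n in
    pos⇒≉0 (ρ-pos j j≤m) (solve 1 (λ r → r := :- (:- r)) refl (ρ j)
      ⨾ -‿cong (sym t≈ ⨾ t≈0) ⨾ solve 0 (:- :0 := :0) refl)

  x₀∈I : InInterval x₀
  x₀∈I = centred⇒interval
    ( ≤-respʳ-≈ (*-congˡ (sym x₀≈)) (proj₁ (-ρ-centred 0 ℕ.z≤n))
    , <-respˡ-≈ (*-congˡ (sym x₀≈)) (proj₂ (-ρ-centred 0 ℕ.z≤n)))

  DE-pos : ∀ {j} → j ℕ.≤ m → 0# < D j * E j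
  DE-pos j≤m = *-pos (D-pos _ (ℕ.m≤n⇒m≤1+n (ℕ.m≤n⇒m≤1+n j≤m))) (E-pos _ (ℕ.m≤n⇒m≤1+n j≤m))

  -- `b - a * ρ j` is the denominator of Θ = a / (b + a t) at t = - ρ_j. Expressing b through K
  -- leaves the constant of `wronskian`, so up to the bounded K the quotient Θ is D_j E_j / (2 D_0
  -- E_0).
  width≈ : ∀ {j a b} → j ℕ.≤ m →
    D j * E j * (b + - (a * ρ j)) ≈ E j * K j a b + a * (2# * (D 0 * E 0))
  width≈ {j} {a} {b} j≤m =
    modulo (E*ρ j (ℕ.m≤n⇒m≤1+n j≤m)) (- (a * D j)) (modulo (wronskian j) a
      (solve 8 (λ a b d d′ e e′ r w →
         d :* e :* (b :- a :* r) :+ :- (a :* d) :* e′ :+ a :* w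
         := e :* (d :* b :- a :* d′) :+ a :* w :+ :- (a :* d) :* (e :* r) :+ a :* (d′ :* e :- d :* e′))
        refl a b (D j) (D (suc j)) (E j) (E (suc j)) (ρ j) (2# * (D 0 * E 0))))

  width-nonneg : ∀ {j a b} → j ℕ.≤ m → 0# ≤ a → 0# ≤ K j a b → 0# ≤ b + - (a * ρ j)
  width-nonneg {j} {a} {b} j≤m 0≤a 0≤K = *-cancelˡ-≤ _ _ (DE-pos j≤m)
    (≤-respˡ-≈ (sym (zeroʳ _)) (≤-respʳ-≈ (sym (width≈ {b = b} j≤m))
      (+-nonneg (*-nonneg (inj₁ (E-pos j (ℕ.m≤n⇒m≤1+n j≤m))) 0≤K)
        (*-nonneg 0≤a (*-nonneg (inj₁ 0<2) (inj₁ (*-pos 0<D₀ (E-pos 0 ℕ.z≤n))))))))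

  width-bound : ∀ {j a b} → j ℕ.≤ m → 0# ≤ a → K j a b ≤ D 0 →
                b + - (a * ρ j) ≤ 1# + 2# * a
  width-bound {j} {a} {b} j≤m 0≤a K≤ = *-cancelˡ-≤ _ _ (DE-pos j≤m)
    (≤-respˡ-≈ (sym (width≈ {b = b} j≤m)) (≤-by
      (+-nonneg
        (*-nonneg (inj₁ (E-pos j j≤1+m)) (x≤y⇒0≤y-x (≤-trans K≤ (D₀≤D j (ℕ.m≤n⇒m≤1+n j≤1+m)))))
        (*-nonneg (*-nonneg (inj₁ 0<2) 0≤a) (x≤y⇒0≤y-x (D₀E₀≤DE j j≤1+m))))
      (solve 5 (λ a d e k w →
         e :* k :+ a :* (:2 :* w) :+ (e :* (d :- k) :+ :2 :* a :* (d :* e :- w))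
         := d :* e :* (:1 :+ :2 :* a))
        refl a (D j) (E j) (K j a b) (D 0 * E 0))))
    where j≤1+m = ℕ.m≤n⇒m≤1+n j≤m

  -- K ≥ 0 bounds b / a below by D_{j+1} / D_j = 1 + (2 - lam) C_{j+1} / D_j, and C_{j+1} ≥ D_j.
  K-growth : ∀ {j a b} → j ℕ.≤ m → 0# ≤ a → 0# ≤ K j a b → a + (2# + - lam) * a ≤ b
  K-growth {j} {a} {b} j≤m 0≤a 0≤K = *-cancelˡ-≤ _ _ (D-pos j (ℕ.m≤n⇒m≤1+n (ℕ.m≤n⇒m≤1+n j≤m)))
    (≤-by (+-nonneg 0≤K (*-nonneg (*-nonneg 0≤a (inj₁ 0<2-lam)) (x≤y⇒0≤y-x (D≤Cₛ j j≤m))))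
      (solve 5 (λ a b c c′ l →
         let d = c :- c′ ; d′ = c′ :- (l :* c′ :- c) in
         d :* (a :+ (:2 :- l) :* a) :+ (d :* b :- a :* d′ :+ a :* (:2 :- l) :* (c′ :- d))
         := d :* b)
        refl a b (C j) (C (suc j)) lam))

  S-growth : ∀ n → 1# + ι n * (2# + - lam) ≤ S x₀ n
  S-growth zero    = inj₂ (solve 1 (λ l → :1 :+ :0 :* (:2 :- l) := :1) refl lam)
  S-growth (suc n) =
    let j , j≤m , _ , 0≤a , _ , 0≤K , _ = tracked (suc n)
        0≤σ = inj₁ 0<2-lam
        IH  = S-growth n
        1≤S = ≤-trans (≤-by (*-nonneg (ι-nonneg n) 0≤σ) refl) IH
    in ≤-trans
      (≤-by (+-nonneg (x≤y⇒0≤y-x IH) (*-nonneg 0≤σ (x≤y⇒0≤y-x 1≤S)))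
        (solve 3 (λ k σ s →
           :1 :+ (:1 :+ k) :* σ :+ (s :- (:1 :+ k :* σ) :+ σ :* (s :- :1)) := s :+ σ :* s)
          refl (ι n) (2# + - lam) (S x₀ n)))
      (K-growth j≤m 0≤a 0≤K)

  open Approximation x₀ x₀-irrational using (Θ-lower)

  Θ-eventually-> : ∀ c → c < ½ → ∃ λ N → ∀ n → N ℕ.≤ n → c < Θ x₀ n
  Θ-eventually-> c c<½ = N , λ n N≤n →
    let j , j≤m , t≈ , 0≤a , 0<b , 0≤K , K≤ = tracked (suc n)
        0<S = proj₁ (proj₂ (proj₂ (proj₂ (proj₂ (tracked n)))))
        w≈  = +-congˡ (*-congˡ t≈ ⨾ solve 2 (λ a r → a :* :- r := :- (a :* r)) refl (S x₀ n) (ρ j))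
    in Θ-lower n c 0<S (<-respˡ-≈ (*-congˡ (sym w≈))
         (small-enough (width-nonneg j≤m 0≤a 0≤K) (width-bound j≤m 0≤a K≤) 0<S
           (<-≤-trans Nσγ>c
             (*-monoˡ-≤ (inj₁ 0<γ)
               (≤-trans (≤-by (+-nonneg (inj₁ 0<1)
                               (*-nonneg (inj₁ 0<2-lam) (x≤y⇒0≤y-x (ι-mono-≤ N≤n))))
                          (solve 3 (λ s k l → s :* k :+ (:1 :+ s :* (l :- k)) := :1 :+ l :* s)
                            refl σ (ι N) (ι n)))
                 (S-growth n))))))
    where
    σ = 2# + - lam
    -- The denominator of Θ is at most 1 + 2S, and for c ≥ 0 the inequality c (1 + 2S) < S means c <
    -- γ S; N comes from S_n ≥ 1 + n σ.
    γ = 1# + - (2# * c)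

    0<γ : 0# < γ
    0<γ = <-respʳ-≈ (+-congʳ 2*½≈1) (x<y⇒0<y-x (*-monoˡ-< 0<2 c<½))

    0<γσ = *-pos 0<γ 0<2-lam
    N    = proj₁ (archimedean (c / (γ * σ)))

    Nσγ>c : c < γ * (σ * ι N)
    Nσγ>c = <-respˡ-≈ (*-/-cancel 0<γσ c) (<-respʳ-≈ (*-assoc _ _ _)
      (*-monoˡ-< 0<γσ (proj₂ (archimedean (c / (γ * σ))))))

    small-enough : ∀ {w s} → 0# ≤ w → w ≤ 1# + 2# * s → 0# < s → c < γ * s → c * w < s
    small-enough {w} {s} 0≤w w≤ 0<s c<γs with ≤⊎> 0# c
    ... | inj₁ 0≤c = ≤-<-trans (*-monoˡ-≤ 0≤c w≤)
      (<-by (x<y⇒0<y-x c<γs)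
        (solve 2 (λ c s → c :* (:1 :+ :2 :* s) :+ ((:1 :- :2 :* c) :* s :- c) := s) refl c s))
    ... | inj₂ c<0 = <-by (+-pos-nonneg 0<s (*-nonneg (inj₁ (0<-x c<0)) 0≤w))
      (solve 3 (λ c w s → c :* w :+ (s :+ :- c :* w) := s) refl c w s)

  lower : ∀ c → c < ½ → ¬ IsApproximationConstant c
  lower c c<½ approximates =
    let N , c<Θ         = Θ-eventually-> c c<½
        n , N≤n , Θ≤c   = approximates x₀ x₀∈I x₀-irrational N
    in <⇒≱ (c<Θ n N≤n) Θ≤c

-- From the angle π/q to the signs of the Chebyshev values.

module HeckeAngle (ℝ : CompleteOrderedField)
  (cos : CompleteOrderedField.Carrier ℝ → CompleteOrderedField.Carrier ℝ)
  (isCosine : Real.IsCosine ℝ cos)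
  (π : CompleteOrderedField.Carrier ℝ) (isPi : Real.IsPi ℝ cos π) (m : ℕ)
  where
  open CompleteOrderedField ℝ
  open Real ℝ
  open IntegerCoefficients ℝ
  open OrderedField ℝ
  open Cosine ℝ cos isCosine
  open Mult semiring using (×1-homo-*)

  p q : ℕ
  p = suc (suc m)
  q = 2 ℕ.* p

  θ lam : Carrier
  θ   = π / ι q
  lam = 2# * cos θ

  open Chebyshev ℝ lam

  0<q : 0# < ι q
  0<q = ι-pos (ℕ.pred q)

  0<θ : 0# < θ
  0<θ = *-pos (proj₁ isPi) (⁻¹-pos 0<q)

  pθ≈π/2 : ι p * θ ≈ π / 2#
  pθ≈π/2 = *-cancelˡ-≈ _ _ 0<2
    (sym (*-assoc _ _ _) ⨾ *-congʳ (sym (×1-homo-* 2 p))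
     ⨾ *-/-cancel 0<q π ⨾ sym (*-/-cancel 0<2 π))

  C≈2cos : ∀ n → C n ≈ 2# * cos (ι n * θ)
  C≈2cos zero          = sym (*-congˡ (cos-cong (zeroˡ θ) ⨾ cos-0) ⨾ *-identityʳ 2#)
  C≈2cos (suc zero)    = *-congˡ (cos-cong (solve 1 (λ t → t := (:1 :+ :0) :* t) refl θ))
  C≈2cos (suc (suc n)) =
    +-cong (*-congˡ (C≈2cos (suc n))) (-‿cong (C≈2cos n))
    ⨾ modulo (cos-product (ι (suc n) * θ) θ) (- 2#)
        (solve 4 (λ a b c d →
           :2 :* b :* (:2 :* a) :- :2 :* d :+ :- :2 :* (:2 :* (a :* b))
           := :2 :* c :+ :- :2 :* (c :+ d))
          refl (cos (ι (suc n) * θ)) (cos θ) (cos (ι (suc n) * θ + θ)) (cos (ι n * θ))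
         ⨾ +-congˡ (*-congˡ (+-congˡ (cos-cong
             (solve 2 (λ k t → k :* t := (:1 :+ k) :* t :- t) refl (ι n) θ)))))
    ⨾ *-congˡ (cos-cong (solve 2 (λ k t → (:1 :+ k) :* t :+ t := (:1 :+ (:1 :+ k)) :* t) refl (ι n) θ))

  C-zero : C p ≈ 0#
  C-zero = C≈2cos p ⨾ *-congˡ (cos-cong pθ≈π/2 ⨾ proj₁ (proj₂ isPi)) ⨾ zeroʳ 2#

  C-pos : ∀ j → j ℕ.≤ suc m → 0# < C j
  C-pos zero    _     = 0<2
  C-pos (suc j) j<1+m = <-respʳ-≈ (sym (C≈2cos (suc j))) (*-pos 0<2
    (cos-positive (π / 2#) (proj₂ (proj₂ isPi)) (ι (suc j) * θ) (*-pos (ι-pos j) 0<θ)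
      (<-by (*-pos 0<θ (+-pos-nonneg 0<1 (x≤y⇒0≤y-x (ι-mono-≤ j<1+m))))
        (solve 3 (λ t k l → k :* t :+ t :* (:1 :+ (l :- k)) := (:1 :+ l) :* t)
           refl θ (ι (suc j)) (ι (suc m))
         ⨾ pθ≈π/2))))

theorem13 : (ℝ : CompleteOrderedField) →
    let open CompleteOrderedField ℝ
        open Real ℝ in
    (cos : Carrier → Carrier) → IsCosine cos →
    (π : Carrier) → IsPi cos π →
    (p : ℕ) → 2 ℕ.≤ p →
    let q = 2 ℕ.* p
        lam = 2# * cos (π / ι q)
        open Rosen ℝ lam in
    IsApproximationConstant ½ ×
    (∀ c → c < ½ → ¬ IsApproximationConstant c)
theorem13 ℝ cos isCosine π isPi (suc (suc m)) (ℕ.s≤s (ℕ.s≤s ℕ.z≤n)) =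
  HurwitzBound.upper ℝ lam m C-pos C-zero , Extremal.lower ℝ lam m C-pos C-zero
  where open HeckeAngle ℝ cos isCosine π isPi m
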